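{- Let $\beta=(\beta_1,\ldots,\beta_{2\ell})$ be a composition with an even number of parts, and let $\overline{F}(\beta)$ be the corresponding circular fence. The map $\overline{\Phi}$ defined by steps (PHC1)–(PHC3) below is a cardinality-preserving bijection from the set of lower order ideals of $\overline{F}(\beta)$ to the set of upper order ideals (filters) of $\overline{F}(\beta)$.
   Context: With $n=\sum\beta_i$, the fence $F(\beta)$ (obtained from chains $S_1,\dots,S_{2\ell}$, $\#S_i=\beta_i+1$, by identifying maximal elements of $S_i,S_{i+1}$ for $i$ odd and minimal elements for $i$ even) has elements $x_1,\dots,x_{n+1}$ left to right; $\overline{F}(\beta)$ is obtained by identifying $x_1$ and $x_{n+1}$. Its ascending segments are $A_i=S_{2i-1}$ and descending segments $D_i=S_{2i}$, $1\le i\le\ell$. Let $\tilde A_i$ be the set of elements of $A_i$ not lying on another segment, $\alpha_i=\beta_{2i-1}=1+\#\tilde A_i$, $\delta_i=\beta_{2i}$ (so $\#D_i=\delta_i+1$); the $\tilde A_i$ and $D_i$ partition $\overline{F}(\beta)$. A lower order ideal $I$ is encoded by $a_i=\#(I\cap\tilde A_i)$, $d_i=\#(I\cap D_i)$, and a filter $U$ by $b_i=\#(U\cap\tilde A_i)$, $e_i=\#(U\cap D_i)$; these determine $I$, $U$. All indices are taken modulo $\ell$. Linear map $\phi$ on finite sequences of nonnegative integers: a block is a maximal run of consecutive positive entries, its trailing ones $T$ is its maximal (possibly empty) final segment of ones, $B'$ is $B$ with $T$ removed; (P1) for each block with nonempty $T$, exchange $T$ with the $0$ immediately following it; (P2)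 for each block with $\#B'\ge2$, decrease the last entry of $B'$ by $1$ and increase its first entry by $1$. Circular map $\overline{\phi}$: if all entries of $d$ are positive it returns $d$; otherwise it applies (P1),(P2) to $d$ regarded as a circular sequence ($d_\ell$ followed by $d_1$, blocks being maximal cyclic runs of positive entries). Given $I$ encoded by $(a,d)$: (PHC1) for every $i\in[\ell]$ with $d_i=1$ and $a_{i+1}<\alpha_{i+1}-1$, set $d_i:=0$, $a_{i+1}:=a_{i+1}+1$. (PHC2) If some $i\in[\ell]$ has $a_i<\alpha_i-1$, cut the circular sequence $d$ between $d_{i-1}$ and $d_i$ for each such $i$, producing linear factors (runs of cyclically consecutive entries), apply $\phi$ to each factor and put the results back in the same positions; if no such $i$ exists, apply $\overline{\phi}$ to $d$. Call the result $e$ and set $b:=a$. (PHC3) For every $i\in[\ell]$ with $e_i=0$ and $b_i>0$, set $e_i:=1$, $b_i:=b_i-1$. Then $\overline{\Phi}(I)$ is the filter encoded by $(b,e)$. -}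

module Defs where

open import Data.Nat using (ℕ; zero; suc; _+_; _∸_; _<_; _≤ᵇ_; _<ᵇ_; _≡ᵇ_)
open import Data.Bool using (Bool; true; false; _∧_; _∨_; if_then_else_)
open import Data.Fin using (Fin; zero; suc; toℕ; fromℕ; inject₁)
open import Data.Fin.Subset using (Subset; _∈_)
open import Data.Vec using (Vec; []; _∷_; tabulate)
open import Data.List using (List; []; _∷_; _++_; [_]; reverse; drop; take; length)
import Data.List as L
open import Data.Product using (_×_; _,_)
open import Data.Sum using (_⊎_)
open import Relation.Binary.PropositionalEquality using (_≡_)
open import Relation.Binary.Construct.Closure.ReflexiveTransitive using (Star)

sumFin : ∀ {m} → (Fin m → ℕ) → ℕ
sumFin {zero}  f = 0
sumFin {suc m} f = f zero + sumFin (λ i → f (suc i))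

preFin : ∀ {m} → (Fin m → ℕ) → Fin m → ℕ
preFin f zero    = 0
preFin f (suc i) = f zero + preFin (λ j → f (suc j)) i

anyFin : ∀ {m} → (Fin m → Bool) → Bool
anyFin {zero}  f = false
anyFin {suc m} f = f zero ∨ anyFin (λ i → f (suc i))

nextFin : ∀ {m} → Fin m → Fin m
nextFin {suc zero}    zero    = zero
nextFin {suc (suc m)} zero    = suc zero
nextFin {suc (suc m)} (suc i) with nextFin {suc m} i
... | zero   = zero
... | suc j  = suc (suc j)

prevFin : ∀ {m} → Fin m → Fin m
prevFin {suc m} zero    = fromℕ m
prevFin {suc m} (suc i) = inject₁ i

countBelow : (ℕ → Bool) → ℕ → ℕ
countBelow f zero    = 0
countBelow f (suc m) = countBelow f m + (if f m then 1 else 0)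

lookupℕ : ∀ {m} → Vec Bool m → ℕ → Bool
lookupℕ []       _       = false
lookupℕ (x ∷ xs) zero    = x
lookupℕ (x ∷ xs) (suc k) = lookupℕ xs k

lookupL : List ℕ → ℕ → ℕ
lookupL []       _       = 0
lookupL (x ∷ xs) zero    = x
lookupL (x ∷ xs) (suc k) = lookupL xs k

rotate : ∀ {A : Set} → ℕ → List A → List A
rotate k xs = drop k xs ++ take k xs

firstIndex : ∀ {A : Set} → (A → Bool) → List A → ℕ
firstIndex p []       = 0
firstIndex p (x ∷ xs) = if p x then 0 else suc (firstIndex p xs)

allL : ∀ {A : Set} → (A → Bool) → List A → Bool
allL p []       = true
allL p (x ∷ xs) = p x ∧ allL p xs

anyL : ∀ {A : Set} → (A → Bool) → List A → Bool
anyL p []       = false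
anyL p (x ∷ xs) = p x ∨ anyL p xs

isZero : ℕ → Bool
isZero zero    = true
isZero (suc _) = false

spanOnes : List ℕ → List ℕ × List ℕ
spanOnes (suc zero ∷ xs) with spanOnes xs
... | (os , r) = (suc zero ∷ os , r)
spanOnes xs = ([] , xs)

decLast : List ℕ → List ℕ
decLast []           = []
decLast (x ∷ [])     = (x ∸ 1) ∷ []
decLast (x ∷ y ∷ ys) = x ∷ decLast (y ∷ ys)

p2 : List ℕ → List ℕ
p2 (x ∷ y ∷ ys) = suc x ∷ decLast (y ∷ ys)
p2 xs           = xs

-- given a block B stored in reverse, return (B'' , T) where T is the
-- trailing ones of B and B'' is B' = B without T after applying (P2)
splitBlock : List ℕ → List ℕ × List ℕ
splitBlock revB with spanOnes revB
... | (T , revB') = (p2 (reverse revB') , T)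

-- the current block (reversed) is followed by a 0: (P1) exchanges T with that 0
flushZero : List ℕ → List ℕ
flushZero revB with splitBlock revB
... | (B'' , T) = B'' ++ (0 ∷ T)

-- the current block (reversed) ends the sequence: no following 0, so T stays
flushEnd : List ℕ → List ℕ
flushEnd revB with splitBlock revB
... | (B'' , T) = B'' ++ T

-- scan the sequence; first argument: current block, reversed
φgo : List ℕ → List ℕ → List ℕ
φgo acc []            = flushEnd acc
φgo acc (zero ∷ xs)   = flushZero acc ++ φgo [] xs
φgo acc (suc k ∷ xs)  = φgo (suc k ∷ acc) xs

φ : List ℕ → List ℕ
φ = φgo []

-- The circular map φ̄: if all entries positive, identity; otherwise rotate
-- so that the sequence ends with a 0 (so cyclic blocks = linear blocks, each
-- followed by a 0), apply φ, and rotate back.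
φ̄ : List ℕ → List ℕ
φ̄ d with allL (λ x → 1 ≤ᵇ x) d
... | true  = d
... | false =
  let k = suc (firstIndex isZero d)
  in rotate (length d ∸ k) (φ (rotate k d))

-- (PHC2) with cuts: input pairs (cut before this entry?, entry) of a sequence
-- whose first entry carries a cut; apply φ to every factor.
cutGo : List ℕ → List (Bool × ℕ) → List ℕ
cutGo acc []                 = φ (reverse acc)
cutGo acc ((true  , x) ∷ xs) = φ (reverse acc) ++ cutGo (x ∷ []) xs
cutGo acc ((false , x) ∷ xs) = cutGo (x ∷ acc) xs

-- cuts c_i (true iff the circular sequence is cut between d_{i-1} and d_i)
phc2 : List Bool → List ℕ → List ℕ
phc2 cuts d with anyL (λ b → b) cuts
... | false = φ̄ d
... | true  =
  let c = firstIndex (λ b → b) cuts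
  in rotate (length d ∸ c) (cutGo [] (rotate c (L.zip cuts d)))

-- The circular fence F̄(β) for β = (α₁, δ₁, α₂, δ₂, …, α_ℓ, δ_ℓ)
-- (α i = β_{2i-1}, δ i = β_{2i}, 0-based i : Fin ℓ).

module Fence (ℓ : ℕ) (α δ : Fin ℓ → ℕ) where

  n : ℕ
  n = sumFin (λ i → α i + δ i)

  -- Elements x_1,…,x_n are the positions 0,…,n-1 (position r ↦ x_{r+1});
  -- position n denotes x_{n+1} = x_1.
  -- A_i occupies positions p i, …, p i + α i  (p i = its minimum)
  -- D_i occupies positions t i, …, t i + δ i  (t i = p i + α i = its maximum)
  p : Fin ℓ → ℕ
  p = preFin (λ i → α i + δ i)

  t : Fin ℓ → ℕ
  t i = p i + α i

  -- the element x : Fin n sits at position r ∈ [0, n]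
  _≐_ : Fin n → ℕ → Set
  x ≐ r = (toℕ x ≡ r) ⊎ (toℕ x + n ≡ r)

  data _⋖_ : Fin n → Fin n → Set where
    asc  : ∀ {x y} (i : Fin ℓ) (k : ℕ) → k < α i →
           x ≐ (p i + k) → y ≐ (p i + suc k) → x ⋖ y
    desc : ∀ {x y} (i : Fin ℓ) (k : ℕ) → k < δ i →
           y ≐ (t i + k) → x ≐ (t i + suc k) → x ⋖ y

  _≤F_ : Fin n → Fin n → Set
  _≤F_ = Star _⋖_

  IsIdeal : Subset n → Set
  IsIdeal I = ∀ {x y} → y ≤F x → x ∈ I → y ∈ I

  IsFilter : Subset n → Set
  IsFilter U = ∀ {x y} → x ≤F y → x ∈ U → y ∈ U

  elemAt : Subset n → ℕ → Bool
  elemAt S r = if r <ᵇ n then lookupℕ S r else lookupℕ S (r ∸ n)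

  -- encoding of a lower order ideal: a i = #(I ∩ Ã_i), d i = #(I ∩ D_i)
  -- (Ã_i = positions p i + 1, …, p i + α i - 1)
  encA : Subset n → Fin ℓ → ℕ
  encA I i = countBelow (λ k → elemAt I (p i + suc k)) (α i ∸ 1)

  encD : Subset n → Fin ℓ → ℕ
  encD I i = countBelow (λ k → elemAt I (t i + k)) (suc (δ i))

  -- filter encoded by (b , e): top b i elements of Ã_i, top e i elements of D_i
  decodeFilter : (Fin ℓ → ℕ) → (Fin ℓ → ℕ) → Subset n
  decodeFilter b e = tabulate λ x → anyFin λ i →
       inR (toℕ x) (t i ∸ b i) (t i)
     ∨ inR (toℕ x) (t i) (t i + e i)
     ∨ inR (toℕ x + n) (t i) (t i + e i)
    where
    inR : ℕ → ℕ → ℕ → Bool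
    inR q lo hi = (lo ≤ᵇ q) ∧ (q <ᵇ hi)

  module _ (I : Subset n) where
    a₀ d₀ : Fin ℓ → ℕ
    a₀ = encA I
    d₀ = encD I

    phc1cond : Fin ℓ → Bool
    phc1cond i = (d₀ i ≡ᵇ 1) ∧ (a₀ (nextFin i) <ᵇ (α (nextFin i) ∸ 1))

    d₁ : Fin ℓ → ℕ
    d₁ i = if phc1cond i then 0 else d₀ i

    a₁ : Fin ℓ → ℕ
    a₁ j = if phc1cond (prevFin j) then suc (a₀ j) else a₀ j

    cuts : List Bool
    cuts = L.tabulate λ i → a₁ i <ᵇ (α i ∸ 1)

    eList : List ℕ
    eList = phc2 cuts (L.tabulate d₁)

    e₂ b₂ : Fin ℓ → ℕ
    e₂ i = lookupL eList (toℕ i)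
    b₂ = a₁

    phc3cond : Fin ℓ → Bool
    phc3cond i = isZero (e₂ i) ∧ (1 ≤ᵇ b₂ i)

    e₃ b₃ : Fin ℓ → ℕ
    e₃ i = if phc3cond i then 1 else e₂ i
    b₃ i = if phc3cond i then b₂ i ∸ 1 else b₂ i

    Φ̄ : Subset n
    Φ̄ = decodeFilter b₃ e₃

{-# OPTIONS --safe #-}
module Submission where

-- The map φ is computed by a letter-to-letter automaton reading d and writing e, and a
-- circular run of this automaton with cuts is a symmetric notion: read backwards, with d
-- and e exchanged, it is again a run.  (PHC1) and the inverse of (PHC3) are mirror images
-- of each other too, so the relation "(b , e) encodes the image of (a , d)" is symmetric
-- under reversing the circle.  Hence it suffices to show that it is functional and total,
-- that it takes codes of ideals to codes of filters and that it preserves the sum.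
-- Runs on the same input pass through the same states unless d is all ones, when every run
-- is the identity.

open import Defs
open import Data.Bool using (Bool; true; false; _∧_; _∨_; if_then_else_)
open import Data.Bool.Properties using (∨-zeroʳ)
open import Data.Empty using (⊥; ⊥-elim)
open import Data.Fin using (Fin; zero; suc; toℕ; fromℕ; fromℕ<; inject₁; opposite)
open import Data.Fin.Induction using (<-weakInduction; <-weakInduction-startingFrom)
open import Data.Fin.Properties using (opposite-involutive; ≤fromℕ; toℕ-fromℕ<; toℕ<n)
open import Data.Fin.Relation.Unary.Top using (view; ‵fromℕ; ‵inj₁)
open import Data.Fin.Subset using (Subset; ∣_∣; _∈_)
open import Data.List using (List; []; _∷_; _++_; _∷ʳ_; map; reverse; replicate; length; take; drop; zip; tabulate)
open import Data.List.Properties using (++-assoc; ++-identityʳ; length-++; length-map; length-tabulate; map-++; reverse-++; unfold-reverse; ∷ʳ-++; ∷ʳ-injectiveʳ)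
open import Data.List.Relation.Unary.All using (All; []; _∷_)
open import Data.List.Relation.Unary.All.Properties using (++⁻ʳ; ∷ʳ⁺)
open import Data.Nat using (ℕ; zero; suc; _+_; _∸_; _≤_; _<_; _<ᵇ_; _≤ᵇ_; _≡ᵇ_; z≤n; s≤s)
open import Data.Nat.Properties
open import Data.Nat.Tactic.RingSolver using (solve-∀)
open import Data.Product using (Σ; ∃; _×_; _,_; proj₁; proj₂)
open import Data.Sum using (_⊎_; inj₁; inj₂)
open import Data.Vec as Vec using (Vec; []; _∷_; lookup)
open import Data.Vec.Properties using (lookup∘tabulate; lookup⇒[]=; []=⇒lookup; tabulate∘lookup; tabulate-cong)
open import Function using (_∘_)
open import Relation.Binary.Construct.Closure.ReflexiveTransitive using (ε; _◅_)
open import Relation.Binary.PropositionalEquality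
open import Relation.Nullary using (yes; no)

-- The automaton of φ

-- On a circle no entry comes first, so a run is a labelling of all places by states that is checked
-- locally; its existence and its uniqueness are then separate questions. The delicate place is the
-- end of a linear factor: there `φ` leaves trailing ones where they are, which no complete segment
-- B′ T 0 does. (PHC1) prevents this. A cut at `i` says that Ã `i` is still not full, and then
-- (PHC1) cannot have left a 1 just before the cut. The mirror image, that no output entry right
-- after a cut is 1, makes (PHC3) reversible. On the level of codes, the lengths δ matter only for
-- the bound δ + 1 on an entry. Equality means that all of D is present; in an ideal its maximum
-- then forces the ascending segment below it, in a filter its minimum forces the one above it. (P2)
-- can create such an entry, so this condition must be followed through all the steps.

record Cycle (ℓ : ℕ) : Set₁ where
  field
    pv nx  : Fin ℓ → Fin ℓ
    pv-nx  : ∀ i → pv (nx i) ≡ i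
    nx-pv  : ∀ i → nx (pv i) ≡ i
    induct : (P : Fin ℓ → Set) → (∀ i → P (pv i) → P i) → ∀ j → P j → ∀ i → P i

-- Backward induction is forward induction on the implication `P k → P i`: it is trivial at `k = i`,
-- spreads forward and so reaches `j`.
opp : ∀ {ℓ} → Cycle ℓ → Cycle ℓ
opp C = record
  { pv     = nx
  ; nx     = pv
  ; pv-nx  = nx-pv
  ; nx-pv  = pv-nx
  ; induct = λ P back j Pj i →
      induct (λ k → P k → P i)
        (λ k to Pk → to (back (pv k) (subst P (sym (nx-pv k)) Pk)))
        i (λ Pi → Pi) j Pj
  }
  where open Cycle C

-- φ cuts d into segments B′ T 0 and replaces each by B″ 0 T.  The states are the possible
-- places between two entries: before B′ (start), strictly inside B′ (inner), between B′
-- and T 0 (done), strictly inside T 0 (ones).  Step s x y τ: the entry x becomes y.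
data State : Set where
  start inner done ones : State

private variable
  ℓ f x x′ x″ y y′ y″ v w : ℕ
  c         : Bool
  s s′ τ τ′ o u : State
  zs zs′    : List (Bool × ℕ)
  xs ys ys′ : List ℕ

data Idle : State → Set where
  start : Idle start
  done  : Idle done

data Step : State → ℕ → ℕ → State → Set where
  zero-stays  : Step done  0             0             start
  tail-opens  : Step done  1             0             ones
  tail-runs   : Step ones  1             1             ones
  tail-closes : Step ones  0             1             start
  single      : ∀ x → Step start (suc (suc x)) (suc (suc x)) done
  opens       : ∀ x → Step start (suc x)       (suc (suc x)) inner
  runs        : ∀ x → Step inner (suc x)       (suc x)       inner
  closes      : ∀ x → Step inner (suc (suc x)) (suc x)       done

-- Between consecutive entries the state persists, except that an empty B′ turns start into
-- done; a cut can only occur where no segment is open.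
data Link : Bool → State → State → Set where
  same  : Link false s s
  empty : Link false start done
  cut   : Idle s → Idle τ → Link true s τ

record IsRun (pv : Fin ℓ → Fin ℓ) (cuts : Fin ℓ → Bool) (d e : Fin ℓ → ℕ) : Set where
  field
    inn out : Fin ℓ → State
    link    : ∀ i → Link (cuts i) (out (pv i)) (inn i)
    step    : ∀ i → Step (inn i) (d i) (e i) (out i)

-- Reversal with d and e exchanged takes T 0 over 0 T to itself, and B′ over B″ to a pair of the
-- same kind. The inside states are therefore fixed, while the two boundaries, before B′ and after
-- B′, are swapped.
mirror : State → State
mirror start = done
mirror inner = inner
mirror done  = start
mirror ones  = ones

mirror-idle : Idle s → Idle (mirror s)
mirror-idle start = done
mirror-idle done  = start

mirror-link : Link c s τ → Link c (mirror τ) (mirror s)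
mirror-link same      = same
mirror-link empty     = empty
mirror-link (cut p q) = cut (mirror-idle q) (mirror-idle p)

mirror-step : Step s x y τ → Step (mirror τ) y x (mirror s)
mirror-step zero-stays  = zero-stays
mirror-step tail-opens  = tail-closes
mirror-step tail-runs   = tail-runs
mirror-step tail-closes = tail-opens
mirror-step (single x)  = single x
mirror-step (opens x)   = closes x
mirror-step (runs x)    = runs x
mirror-step (closes x)  = opens x

module _ (C : Cycle ℓ) where
  open Cycle C

  mirror-run : ∀ {cuts d e} → IsRun pv cuts d e → IsRun nx (λ i → cuts (nx i)) e d
  mirror-run {cuts} r = record
    { inn  = λ i → mirror (out i)
    ; out  = λ i → mirror (inn i)
    ; link = λ i → subst (λ j → Link (cuts (nx i)) (mirror (inn (nx i))) (mirror (out j)))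
                     (pv-nx i) (mirror-link (link (nx i)))
    ; step = λ i → mirror-step (step i)
    }
    where open IsRun r

run-cong : ∀ {pv : Fin ℓ → Fin ℓ} {cuts cuts′ d d′ e e′} → (∀ i → cuts i ≡ cuts′ i) → (∀ i → d i ≡ d′ i) →
           (∀ i → e i ≡ e′ i) → IsRun pv cuts d e → IsRun pv cuts′ d′ e′
run-cong {pv = pv} c≗ d≗ e≗ r = record
  { inn  = inn
  ; out  = out
  ; link = λ i → subst (λ b → Link b (out (pv i)) (inn i)) (c≗ i) (link i)
  ; step = λ i → subst₂ (λ x y → Step (inn i) x y (out i)) (d≗ i) (e≗ i) (step i)
  }
  where open IsRun r

-- Uniqueness of runs on a circle

data Clash : State → State → Set where
  ones-inner : Clash ones inner
  done-inner : Clash done inner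

-- The entry alone almost fixes the state after it: `start` after 0, `ones` or `inner` after 1,
-- `done` or `inner` after anything larger.
same-input : Step s x y τ → Step s′ x y′ τ′ → τ ≡ τ′ ⊎ Clash τ τ′ ⊎ Clash τ′ τ
same-input zero-stays  zero-stays  = inj₁ refl
same-input zero-stays  tail-closes = inj₁ refl
same-input tail-opens  tail-opens  = inj₁ refl
same-input tail-opens  tail-runs   = inj₁ refl
same-input tail-opens  (opens _)   = inj₂ (inj₁ ones-inner)
same-input tail-opens  (runs _)    = inj₂ (inj₁ ones-inner)
same-input tail-runs   tail-opens  = inj₁ refl
same-input tail-runs   tail-runs   = inj₁ refl
same-input tail-runs   (opens _)   = inj₂ (inj₁ ones-inner)
same-input tail-runs   (runs _)    = inj₂ (inj₁ ones-inner)
same-input tail-closes zero-stays  = inj₁ refl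
same-input tail-closes tail-closes = inj₁ refl
same-input (single _)  (single _)  = inj₁ refl
same-input (single _)  (opens _)   = inj₂ (inj₁ done-inner)
same-input (single _)  (runs _)    = inj₂ (inj₁ done-inner)
same-input (single _)  (closes _)  = inj₁ refl
same-input (opens _)   tail-opens  = inj₂ (inj₂ ones-inner)
same-input (opens _)   tail-runs   = inj₂ (inj₂ ones-inner)
same-input (opens _)   (single _)  = inj₂ (inj₂ done-inner)
same-input (opens _)   (opens _)   = inj₁ refl
same-input (opens _)   (runs _)    = inj₁ refl
same-input (opens _)   (closes _)  = inj₂ (inj₂ done-inner)
same-input (runs _)    tail-opens  = inj₂ (inj₂ ones-inner)
same-input (runs _)    tail-runs   = inj₂ (inj₂ ones-inner)
same-input (runs _)    (single _)  = inj₂ (inj₂ done-inner)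
same-input (runs _)    (opens _)   = inj₁ refl
same-input (runs _)    (runs _)    = inj₁ refl
same-input (runs _)    (closes _)  = inj₂ (inj₂ done-inner)
same-input (closes _)  (single _)  = inj₁ refl
same-input (closes _)  (opens _)   = inj₂ (inj₁ done-inner)
same-input (closes _)  (runs _)    = inj₂ (inj₁ done-inner)
same-input (closes _)  (closes _)  = inj₁ refl

-- From `done` and `ones` only 0 and 1 can be read, from `inner` only positive entries. The common
-- entry is thus 1, too small for `closes`, and `inner` persists.
clash-spreads : Clash s s′ → Link c s τ → Link c s′ τ′ → ∀ {u u′} →
                Step τ x y u → Step τ′ x y′ u′ → u ≡ ones × u′ ≡ inner
clash-spreads ones-inner same same tail-runs  (runs _) = refl , refl
clash-spreads done-inner same same tail-opens (runs _) = refl , refl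

clash-output : Link c ones τ → Link c inner τ′ → ∀ {u u′} →
               Step τ x y u → Step τ′ x y′ u′ → y ≡ y′
clash-output same same tail-runs (runs _) = refl

step-functional : Step s x y τ → Step s x y′ τ → y ≡ y′
step-functional zero-stays  zero-stays  = refl
step-functional tail-opens  tail-opens  = refl
step-functional tail-runs   tail-runs   = refl
step-functional tail-closes tail-closes = refl
step-functional (single _)  (single _)  = refl
step-functional (opens _)   (opens _)   = refl
step-functional (runs _)    (runs _)    = refl
step-functional (closes _)  (closes _)  = refl

start-done-clash : ∀ {u u′} → Step start x y u → Step done x y′ u′ → Clash u′ u
start-done-clash (opens _) tail-opens = ones-inner

-- The choice between `start` and `done` is the only freedom a link leaves. The next entry settles
-- it, as `start` reads no 0 and `done` nothing above 1; an entry 1 suits both, but then a clash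
-- follows.
idle-agree : Idle s → Idle τ → ∀ {u u′} → Step s x y u → Step τ x y′ u′ →
             s ≡ τ ⊎ Clash u u′ ⊎ Clash u′ u
idle-agree start start _ _ = inj₁ refl
idle-agree start done  p q = inj₂ (inj₂ (start-done-clash p q))
idle-agree done  start p q = inj₂ (inj₁ (start-done-clash q p))
idle-agree done  done  _ _ = inj₁ refl

links-agree : Link c o s → Link c o τ → ∀ {u u′} → Step s x y u → Step τ x y′ u′ →
              s ≡ τ ⊎ Clash u u′ ⊎ Clash u′ u
links-agree same      same      _ _ = inj₁ refl
links-agree same      empty     p q = idle-agree start done p q
links-agree empty     same      p q = idle-agree done start p q
links-agree empty     empty     _ _ = inj₁ refl
links-agree (cut _ a) (cut _ b) p q = idle-agree a b p q

module _ (C : Cycle ℓ) {cuts : Fin ℓ → Bool} {d : Fin ℓ → ℕ} where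
  open Cycle C

  -- Two runs on the same input can only disagree through a clash, and a clash
  -- travels around the whole circle, where it forces d to be constantly 1.
  clash-everywhere : ∀ {e e′} (r : IsRun pv cuts d e) (r′ : IsRun pv cuts d e′) →
    ∀ j → Clash (IsRun.out r j) (IsRun.out r′ j) → ∀ i → e i ≡ e′ i
  clash-everywhere r r′ j cl i with
      induct (λ k → R.out k ≡ ones × R′.out k ≡ inner)
        (λ k (p , q) → clash-spreads (subst₂ Clash (sym p) (sym q) ones-inner)
                         (R.link k) (R′.link k) (R.step k) (R′.step k))
        -- The induction starts one place after `j`, where a clash of `done` with `inner` has
        -- already become one of `ones` with `inner`.
        (nx j)
        (clash-spreads cl
          (subst (λ k → Link (cuts (nx j)) (R.out k) (R.inn (nx j))) (pv-nx j) (R.link (nx j)))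
          (subst (λ k → Link (cuts (nx j)) (R′.out k) (R′.inn (nx j))) (pv-nx j) (R′.link (nx j)))
          (R.step (nx j)) (R′.step (nx j)))
        (pv i)
    where
    module R  = IsRun r
    module R′ = IsRun r′
  ... | p , q =
    clash-output (subst (λ o → Link (cuts i) o (IsRun.inn r i)) p (IsRun.link r i))
                 (subst (λ o → Link (cuts i) o (IsRun.inn r′ i)) q (IsRun.link r′ i))
                 (IsRun.step r i) (IsRun.step r′ i)

  -- An output entry is determined by the input entry and the states on both sides of it, so only
  -- these states have to be compared.
  run-functional : ∀ {e e′} → IsRun pv cuts d e → IsRun pv cuts d e′ → ∀ i → e i ≡ e′ i
  run-functional {e} {e′} r r′ i = by (same-input (R.step (pv i)) (R′.step (pv i)))
    where
    module R  = IsRun r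
    module R′ = IsRun r′

    either : ∀ j → Clash (R.out j) (R′.out j) ⊎ Clash (R′.out j) (R.out j) → e i ≡ e′ i
    either j (inj₁ cl) = clash-everywhere r r′ j cl i
    either j (inj₂ cl) = sym (clash-everywhere r′ r j cl i)

    by : R.out (pv i) ≡ R′.out (pv i) ⊎
         Clash (R.out (pv i)) (R′.out (pv i)) ⊎ Clash (R′.out (pv i)) (R.out (pv i)) →
         e i ≡ e′ i
    by (inj₂ cl) = either (pv i) cl
    by (inj₁ eq) with links-agree (R.link i)
                        (subst (λ o → Link (cuts i) o (R′.inn i)) (sym eq) (R′.link i))
                        (R.step i) (R′.step i)
    ... | inj₂ cl  = either i cl
    ... | inj₁ eq₁ with same-input (R.step i) (R′.step i)
    ...   | inj₂ cl  = either i cl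
    ...   | inj₁ eq₂ = step-functional (R.step i)
              (subst₂ (λ s τ → Step s (d i) (e′ i) τ) (sym eq₁) (sym eq₂) (R′.step i))

-- The number of units carried along an edge, plus one (inside B′ one unit is owed).
weight : State → ℕ
weight start = 1
weight inner = 0
weight done  = 1
weight ones  = 2

step-weight : Step s x y τ → x + weight s ≡ y + weight τ
step-weight zero-stays  = refl
step-weight tail-opens  = refl
step-weight tail-runs   = refl
step-weight tail-closes = refl
step-weight (single _)  = refl
step-weight (opens x)   = cong suc (trans (+-comm x 1) (sym (+-identityʳ (suc x))))
step-weight (runs _)    = refl
step-weight (closes x)  = cong suc (trans (+-identityʳ (suc x)) (+-comm 1 x))

idle-weight : Idle s → weight s ≡ 1
idle-weight start = refl
idle-weight done  = refl

link-weight : Link c s τ → weight s ≡ weight τ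
link-weight same      = refl
link-weight empty     = refl
link-weight (cut p q) = trans (idle-weight p) (sym (idle-weight q))

-- The effect of (PHC1) and (PHC3) on codes

-- Slide f a d a′ d′: with f the capacity of Ã, (PHC1) takes (a , d) to (a′ , d′),
-- and, for filters, (PHC3) takes (a′ , d′) to (a , d).
data Slide (f : ℕ) : ℕ → ℕ → ℕ → ℕ → Set where
  none  : Slide f 0 0 0 0
  moved : ∀ {x} → x < f → Slide f x 1 (suc x) 0
  full  : Slide f f 1 f 1
  large : ∀ {x y} → x ≤ f → Slide f x (suc (suc y)) x (suc (suc y))

slide-functional : Slide f x y x′ y′ → Slide f x y x″ y″ → x′ ≡ x″ × y′ ≡ y″
slide-functional none      none      = refl , refl
slide-functional (moved _) (moved _) = refl , refl
slide-functional (moved p) full      = ⊥-elim (<-irrefl refl p)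
slide-functional full      (moved p) = ⊥-elim (<-irrefl refl p)
slide-functional full      full      = refl , refl
slide-functional (large _) (large _) = refl , refl

-- The result reveals the move: with second entry 0 it is `none` or `moved` according to the first
-- entry, with 1 it is `full`, otherwise `large`.
slide-injective : Slide f x y x″ y″ → Slide f x′ y′ x″ y″ → x ≡ x′ × y ≡ y′
slide-injective none      none      = refl , refl
slide-injective (moved _) (moved _) = refl , refl
slide-injective full      full      = refl , refl
slide-injective (large _) (large _) = refl , refl

slide-sum : Slide f x y x′ y′ → x + y ≡ x′ + y′
slide-sum none              = refl
slide-sum (moved {x = x} _) = trans (+-comm x 1) (sym (+-identityʳ (suc x)))
slide-sum full              = refl
slide-sum (large _)         = refl

slide-full : Slide f x y x′ y′ → 1 ≤ y′ → x′ ≡ f → x ≡ f × 1 ≤ y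
slide-full full      p q = refl , p
slide-full (large _) p q = q , p

full-slide : Slide f x y x′ y′ → 1 ≤ y → x ≡ f → x′ ≡ f × 1 ≤ y′
full-slide (moved p) _ refl = ⊥-elim (<-irrefl refl p)
full-slide full      p q    = refl , p
full-slide (large _) p q    = q , p

slide-≤ : Slide f x y x′ y′ → y′ ≤ y
slide-≤ none      = z≤n
slide-≤ (moved _) = z≤n
slide-≤ full      = ≤-refl
slide-≤ (large _) = ≤-refl

-- Undoing a move turns a 0 into a 1, which the bound must accommodate.
slide-bound : ∀ {m} → 1 ≤ m → Slide f x y x′ y′ → y′ ≤ m → y ≤ m
slide-bound 1≤m none      _ = z≤n
slide-bound 1≤m (moved _) _ = 1≤m
slide-bound 1≤m full      p = p
slide-bound 1≤m (large _) p = p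

slide-large : Slide f x y x′ y′ → 2 ≤ y′ → y ≡ y′
slide-large full      (s≤s ())
slide-large (large _) _ = refl

large-slide : Slide f x y x′ y′ → 2 ≤ y → y′ ≡ y
large-slide (moved _) (s≤s ())
large-slide full      _ = refl
large-slide (large _) _ = refl

<⇒<ᵇ≡true : ∀ {m n} → m < n → (m <ᵇ n) ≡ true
<⇒<ᵇ≡true {zero}  (s≤s _) = refl
<⇒<ᵇ≡true {suc m} (s≤s p) = <⇒<ᵇ≡true p

<ᵇ≡true⇒< : ∀ m n → (m <ᵇ n) ≡ true → m < n
<ᵇ≡true⇒< zero    (suc n) _  = s≤s z≤n
<ᵇ≡true⇒< (suc m) (suc n) eq = s≤s (<ᵇ≡true⇒< m n eq)

≥⇒<ᵇ≡false : ∀ {m n} → n ≤ m → (m <ᵇ n) ≡ false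
≥⇒<ᵇ≡false z≤n     = refl
≥⇒<ᵇ≡false (s≤s p) = ≥⇒<ᵇ≡false p

<ᵇ≡false⇒≥ : ∀ m n → (m <ᵇ n) ≡ false → n ≤ m
<ᵇ≡false⇒≥ m       zero    _  = z≤n
<ᵇ≡false⇒≥ (suc m) (suc n) eq = s≤s (<ᵇ≡false⇒≥ m n eq)

slide-≤-capacity : Slide f x y x′ y′ → x′ ≤ f
slide-≤-capacity none      = z≤n
slide-≤-capacity (moved p) = p
slide-≤-capacity full      = ≤-refl
slide-≤-capacity (large p) = p

-- Indexing: Ã i joins the bottom of D (pv i) to the top of D i, so a unit of Ã i is
-- exchanged with D (pv i) in an ideal and with D i in a filter.
record Rel (pv : Fin ℓ → Fin ℓ) (f a d b e : Fin ℓ → ℕ) : Set where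
  field
    m d₁ e₁ : Fin ℓ → ℕ
    slide₁  : ∀ i → Slide (f i) (a i) (d (pv i)) (m i) (d₁ (pv i))
    run     : IsRun pv (λ i → m i <ᵇ f i) d₁ e₁
    slide₃  : ∀ i → Slide (f i) (b i) (e i) (m i) (e₁ i)

-- Top pv f δ a d: D i is either not exhausted, or its maximum is present and forces
-- the whole of Ã i and the minimum below it.
Top : (pv : Fin ℓ → Fin ℓ) (f δ a d : Fin ℓ → ℕ) → Set
Top pv f δ a d = ∀ i → d i ≤ δ i ⊎ (d i ≡ suc (δ i) × a i ≡ f i × 1 ≤ d (pv i))

module _ (C : Cycle ℓ) where
  open Cycle C

  module _ {f a d b e : Fin ℓ → ℕ} where

    -- Seen from the reversed circle, the Ã that belongs to the index of D `i` is the one at the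
    -- bottom of D `i`, namely Ã `(nx i)`; hence the shift of every family that lives on the Ã.
    mirror-rel : Rel pv f a d b e →
      Rel nx (λ i → f (nx i)) (λ i → b (nx i)) e (λ i → a (nx i)) d
    mirror-rel r = record
      { m      = λ i → m (nx i)
      ; d₁     = e₁
      ; e₁     = d₁
      ; slide₁ = λ i → slide₃ (nx i)
      ; run    = mirror-run C run
      ; slide₃ = λ i → subst (λ j → Slide (f (nx i)) (a (nx i)) (d j) (m (nx i)) (d₁ j))
                         (pv-nx i) (slide₁ (nx i))
      }
      where open Rel r

    rel-functional : ∀ {b′ e′} → Rel pv f a d b e → Rel pv f a d b′ e′ →
                     ∀ i → b i ≡ b′ i × e i ≡ e′ i
    rel-functional r r′ i = slide-injective (R.slide₃ i)
        (subst₂ (Slide (f i) _ _) (sym (m≗ i)) (sym (e₁≗ i)) (R′.slide₃ i))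
      where
      module R  = Rel r
      module R′ = Rel r′

      m≗ : ∀ i → R.m i ≡ R′.m i
      m≗ i = proj₁ (slide-functional (R.slide₁ i) (R′.slide₁ i))

      d₁≗ : ∀ i → R.d₁ i ≡ R′.d₁ i
      d₁≗ i = subst (λ j → R.d₁ j ≡ R′.d₁ j) (pv-nx i)
                (proj₂ (slide-functional (R.slide₁ (nx i)) (R′.slide₁ (nx i))))

      e₁≗ : ∀ i → R.e₁ i ≡ R′.e₁ i
      e₁≗ = run-functional C R.run
              (run-cong (λ i → cong (_<ᵇ f i) (sym (m≗ i))) (λ i → sym (d₁≗ i)) (λ _ → refl) R′.run)

  -- An output δ + 1 comes from `opens` on δ or from `runs` on δ + 1. Both leave the state `inner`,
  -- after which there is no cut and the next output is positive. An input δ + 1 cannot be read from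
  -- `start`: without a cut before it, this would require the previous entry to be 0.
  run-top : ∀ {cuts} {d e δ : Fin ℓ → ℕ} → (∀ i → 1 ≤ δ i) → IsRun pv cuts d e →
    (∀ i → d i ≤ δ i ⊎ (d i ≡ suc (δ i) × cuts i ≡ false × 1 ≤ d (pv i))) →
    ∀ i → e i ≤ δ i ⊎ (e i ≡ suc (δ i) × cuts (nx i) ≡ false × 1 ≤ e (nx i))
  run-top {cuts} {d} {e} {δ} 1≤δ r top i = by (step i) (link i) (top i) (step (pv i)) after
    where
    open IsRun r

    inner-next : ∀ {c s x y τ} → Link c inner s → Step s x y τ → c ≡ false × 1 ≤ y
    inner-next same (runs _)   = refl , s≤s z≤n
    inner-next same (closes _) = refl , s≤s z≤n

    after : out i ≡ inner → cuts (nx i) ≡ false × 1 ≤ e (nx i)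
    after eq = inner-next
      (subst (λ o → Link (cuts (nx i)) o (inn (nx i))) (trans (cong out (pv-nx i)) eq) (link (nx i)))
      (step (nx i))

    starts-after-zero : ∀ {c o s x y} → Link c o start → c ≡ false → Step s x y o → x ≡ 0
    starts-after-zero same _ zero-stays  = refl
    starts-after-zero same _ tail-closes = refl

    split : ∀ {y m} {A : Set} → y ≤ suc m → A → y ≤ m ⊎ (y ≡ suc m × A)
    split {y} {m} p q with m≤n⇒m<n∨m≡n p
    ... | inj₁ (s≤s y≤m) = inj₁ y≤m
    ... | inj₂ y≡        = inj₂ (y≡ , q)

    by : ∀ {c s x y τ o s′ x′ y′} {B : Set} → Step s x y τ → Link c o s →
      x ≤ δ i ⊎ (x ≡ suc (δ i) × c ≡ false × 1 ≤ x′) → Step s′ x′ y′ o →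
      (τ ≡ inner → B) → y ≤ δ i ⊎ (y ≡ suc (δ i) × B)
    by zero-stays  _ _ _ _ = inj₁ z≤n
    by tail-opens  _ _ _ _ = inj₁ z≤n
    by tail-runs   _ _ _ _ = inj₁ (1≤δ i)
    by tail-closes _ _ _ _ = inj₁ (1≤δ i)
    by (single _)  _ (inj₁ p) _ _ = inj₁ p
    by (single _)  l (inj₂ (_ , c≡ , p)) st _ with starts-after-zero l c≡ st | p
    ... | refl | ()
    by (opens _)   _ (inj₁ p) _ k = split (s≤s p) (k refl)
    by (opens _)   l (inj₂ (_ , c≡ , p)) st _ with starts-after-zero l c≡ st | p
    ... | refl | ()
    by (runs _)    _ (inj₁ p) _ k = inj₁ p
    by (runs _)    _ (inj₂ (p , _)) _ k = inj₂ (p , k refl)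
    by (closes _)  _ (inj₁ p) _ _ = inj₁ (≤-trans (n≤1+n _) p)
    by (closes _)  _ (inj₂ (p , _)) _ _ = inj₁ (≤-reflexive (suc-injective p))

  -- An entry δ + 1 is at least 2 and passes through both slides unchanged; in between, a full Ã is
  -- the same as an absent cut, and `run-top` applies.
  rel-top : ∀ {f δ a d b e : Fin ℓ → ℕ} → (∀ i → 1 ≤ δ i) → Rel pv f a d b e → Top pv f δ a d →
            Top nx (λ i → f (nx i)) δ (λ i → b (nx i)) e
  rel-top {f} {δ} {a} {d} {b} {e} 1≤δ r top i = third (run-top 1≤δ run first i)
    where
    open Rel r

    slide-at : ∀ i → Slide (f (nx i)) (a (nx i)) (d i) (m (nx i)) (d₁ i)
    slide-at i = subst (λ j → Slide (f (nx i)) (a (nx i)) (d j) (m (nx i)) (d₁ j)) (pv-nx i) (slide₁ (nx i))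

    first : ∀ i → d₁ i ≤ δ i ⊎ (d₁ i ≡ suc (δ i) × (m i <ᵇ f i) ≡ false × 1 ≤ d₁ (pv i))
    first i with top i
    ... | inj₁ p = inj₁ (≤-trans (slide-≤ (slide-at i)) p)
    ... | inj₂ (p , q , u) with full-slide (slide₁ i) u q
    ...   | m≡f , 1≤d₁ =
      inj₂ ( trans (large-slide (slide-at i) (subst (2 ≤_) (sym p) (s≤s (1≤δ i)))) p
           , ≥⇒<ᵇ≡false (≤-reflexive (sym m≡f)) , 1≤d₁)

    third : e₁ i ≤ δ i ⊎ (e₁ i ≡ suc (δ i) × (m (nx i) <ᵇ f (nx i)) ≡ false × 1 ≤ e₁ (nx i)) →
            e i ≤ δ i ⊎ (e i ≡ suc (δ i) × b (nx i) ≡ f (nx i) × 1 ≤ e (nx i))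
    third (inj₁ p) = inj₁ (slide-bound (1≤δ i) (slide₃ i) p)
    third (inj₂ (p , q , u)) =
      inj₂ ( trans (slide-large (slide₃ i) (subst (2 ≤_) (sym p) (s≤s (1≤δ i)))) p
           , slide-full (slide₃ (nx i)) u m≡f)
      where
      m≡f : m (nx i) ≡ f (nx i)
      m≡f = ≤-antisym (slide-≤-capacity (slide₁ (nx i)))
              (<ᵇ≡false⇒≥ (m (nx i)) (f (nx i)) q)

-- The circle of indices

nextFin-inject₁ : ∀ {m} (i : Fin m) → nextFin (inject₁ i) ≡ suc i
nextFin-inject₁ {suc m} zero = refl
nextFin-inject₁ {suc m} (suc i) rewrite nextFin-inject₁ i = refl

nextFin-fromℕ : ∀ m → nextFin (fromℕ m) ≡ zero
nextFin-fromℕ zero = refl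
nextFin-fromℕ (suc m) rewrite nextFin-fromℕ m = refl

next-prev : ∀ {m} (i : Fin m) → nextFin (prevFin i) ≡ i
next-prev {suc m} zero    = nextFin-fromℕ m
next-prev {suc m} (suc i) = nextFin-inject₁ i

prev-next : ∀ {m} (i : Fin m) → prevFin (nextFin i) ≡ i
prev-next {suc m} i with view i
... | ‵fromℕ           = cong prevFin (nextFin-fromℕ m)
... | ‵inj₁ {i = j} _ = cong prevFin (nextFin-inject₁ j)

opposite-inject₁ : ∀ {m} (i : Fin m) → opposite (inject₁ i) ≡ suc (opposite i)
opposite-inject₁ zero    = refl
opposite-inject₁ (suc i) = cong inject₁ (opposite-inject₁ i)

opposite-prev : ∀ {m} (i : Fin m) → opposite (prevFin i) ≡ nextFin (opposite i)
opposite-prev {suc m} zero    = trans (opposite-involutive zero) (sym (nextFin-fromℕ m))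
opposite-prev {suc m} (suc i) = trans (opposite-inject₁ i) (sym (nextFin-inject₁ (opposite i)))

circle : ∀ ℓ → Cycle ℓ
circle ℓ = record
  { pv     = prevFin
  ; nx     = nextFin
  ; pv-nx  = prev-next
  ; nx-pv  = next-prev
  ; induct = go
  }
  where
  go : ∀ {ℓ} (P : Fin ℓ → Set) → (∀ i → P (prevFin i) → P i) → ∀ j → P j → ∀ i → P i
  go {suc m} P step j Pj =
    -- From `j` the property climbs to the last index, crosses to `zero`, and from there reaches
    -- every index.
    <-weakInduction P
      (step zero (<-weakInduction-startingFrom P Pj (λ k → step (suc k)) (≤fromℕ j)))
      (λ k → step (suc k))

-- Sums over the circle

sumFin-cong : ∀ {m} {f g : Fin m → ℕ} → (∀ i → f i ≡ g i) → sumFin f ≡ sumFin g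
sumFin-cong {zero}  eq = refl
sumFin-cong {suc m} eq = cong₂ _+_ (eq zero) (sumFin-cong (λ i → eq (suc i)))

sumFin-+ : ∀ {m} (f g : Fin m → ℕ) → sumFin (λ i → f i + g i) ≡ sumFin f + sumFin g
sumFin-+ {zero}  f g = refl
sumFin-+ {suc m} f g
  rewrite sumFin-+ (λ i → f (suc i)) (λ i → g (suc i)) =
  interchange (f zero) (g zero) (sumFin (λ i → f (suc i))) (sumFin (λ i → g (suc i)))
  where
  interchange : ∀ a b c d → a + b + (c + d) ≡ a + c + (b + d)
  interchange = solve-∀

sumFin-last : ∀ {m} (f : Fin (suc m) → ℕ) →
              f (fromℕ m) + sumFin (λ i → f (inject₁ i)) ≡ sumFin f
sumFin-last {zero}  f = refl
sumFin-last {suc m} f =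
  trans (swap (f (suc (fromℕ m))) (f zero) (sumFin (λ i → f (suc (inject₁ i)))))
        (cong (f zero +_) (sumFin-last (λ i → f (suc i))))
  where
  swap : ∀ a b c → a + (b + c) ≡ b + (a + c)
  swap = solve-∀

sumFin-prev : ∀ {m} (f : Fin m → ℕ) → sumFin (λ i → f (prevFin i)) ≡ sumFin f
sumFin-prev {zero}  f = refl
sumFin-prev {suc m} f = sumFin-last f

-- Links preserve weights, so around the circle the incoming and the outgoing weights have the same
-- sum and cancel.
run-sum : ∀ {ℓ cuts} {d e : Fin ℓ → ℕ} → IsRun prevFin cuts d e → sumFin d ≡ sumFin e
run-sum {d = d} {e} r = +-cancelʳ-≡ (sumFin (λ i → weight (inn i))) (sumFin d) (sumFin e) (begin
  sumFin d + sumFin (λ i → weight (inn i))  ≡⟨ sumFin-+ d _ ⟨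
  sumFin (λ i → d i + weight (inn i))       ≡⟨ sumFin-cong (λ i → step-weight (step i)) ⟩
  sumFin (λ i → e i + weight (out i))       ≡⟨ sumFin-+ e _ ⟩
  sumFin e + sumFin (λ i → weight (out i))  ≡⟨ cong (sumFin e +_) (sumFin-prev (λ i → weight (out i))) ⟨
  sumFin e + sumFin (λ i → weight (out (prevFin i)))
                                            ≡⟨ cong (sumFin e +_) (sumFin-cong (λ i → link-weight (link i))) ⟩
  sumFin e + sumFin (λ i → weight (inn i))  ∎)
  where
  open ≡-Reasoning
  open IsRun r

rel-sum : ∀ {ℓ} {f a d b e : Fin ℓ → ℕ} → Rel prevFin f a d b e →
          sumFin a + sumFin d ≡ sumFin b + sumFin e
rel-sum {a = a} {d} {b} {e} r = begin
  sumFin a + sumFin d                ≡⟨ cong (sumFin a +_) (sumFin-prev d) ⟨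
  sumFin a + sumFin (d ∘ prevFin)    ≡⟨ sumFin-+ a _ ⟨
  sumFin (λ i → a i + d (prevFin i)) ≡⟨ sumFin-cong (λ i → slide-sum (slide₁ i)) ⟩
  sumFin (λ i → m i + d₁ (prevFin i)) ≡⟨ sumFin-+ m _ ⟩
  sumFin m + sumFin (d₁ ∘ prevFin)   ≡⟨ cong (sumFin m +_) (sumFin-prev d₁) ⟩
  sumFin m + sumFin d₁               ≡⟨ cong (sumFin m +_) (run-sum run) ⟩
  sumFin m + sumFin e₁               ≡⟨ sumFin-+ m _ ⟨
  sumFin (λ i → m i + e₁ i)          ≡⟨ sumFin-cong (λ i → slide-sum (slide₃ i)) ⟨
  sumFin (λ i → b i + e i)           ≡⟨ sumFin-+ b _ ⟩
  sumFin b + sumFin e                ∎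
  where
  open ≡-Reasoning
  open Rel r

-- phc2 computes a run

-- The linear form of `IsRun`, suited to recursion on lists. The indices are the states outside the
-- first link and after the last step, so that a circular run is one from `s` to `s`.
data Run : State → List (Bool × ℕ) → List ℕ → State → Set where
  []   : Run s [] [] s
  cons : Link c s s′ → Step s′ x y o → Run o zs ys τ → Run s ((c , x) ∷ zs) (y ∷ ys) τ

Run-resp : zs ≡ zs′ → Run s zs ys τ → Run s zs′ ys τ
Run-resp refl r = r

_++ᴿ_ : Run s zs ys τ → Run τ zs′ ys′ u → Run s (zs ++ zs′) (ys ++ ys′) u
[]           ++ᴿ r′ = r′
cons l p r   ++ᴿ r′ = cons l p (r ++ᴿ r′)

splitᴿ : ∀ zs {zs′} → Run s (zs ++ zs′) ys u →
  ∃ λ τ → ∃ λ xs → ∃ λ xs′ → ys ≡ xs ++ xs′ × length xs ≡ length zs × Run s zs xs τ × Run τ zs′ xs′ u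
splitᴿ []       r = _ , [] , _ , refl , refl , [] , r
splitᴿ (z ∷ zs) (cons l p r) with splitᴿ zs r
... | τ , xs , xs′ , refl , len , r₁ , r₂ = τ , _ ∷ xs , xs′ , refl , cong suc len , cons l p r₁ , r₂

rotate-length : ∀ {A : Set} (xs ys : List A) → rotate (length xs) (xs ++ ys) ≡ ys ++ xs
rotate-length {A} xs ys = cong₂ _++_ (drops xs) (takes xs)
  where
  drops : ∀ xs → drop (length xs) (xs ++ ys) ≡ ys
  drops []       = refl
  drops (x ∷ xs) = drops xs
  takes : ∀ (xs : List A) → take (length xs) (xs ++ ys) ≡ xs
  takes []       = refl
  takes (x ∷ xs) = cong (x ∷_) (takes xs)

-- A closed run may be opened at any other place; this undoes the rotations that `phc2` and `φ̄`
-- perform.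
rotateᴿ : ∀ zs zs′ → Run s (zs′ ++ zs) ys s → ∃ λ τ → Run τ (zs ++ zs′) (rotate (length zs′) ys) τ
rotateᴿ zs zs′ r with splitᴿ zs′ r
... | τ , xs , xs′ , refl , len , r₁ , r₂
  rewrite sym len | rotate-length xs xs′ = τ , r₂ ++ᴿ r₁

uncut : List ℕ → List (Bool × ℕ)
uncut = map (false ,_)

uncut-++ : ∀ xs ys → uncut (xs ++ ys) ≡ uncut xs ++ uncut ys
uncut-++ = map-++ (false ,_)

_++ᵁ_ : Run s (uncut xs) ys τ → ∀ {xs′} → Run τ (uncut xs′) ys′ u → Run s (uncut (xs ++ xs′)) (ys ++ ys′) u
_++ᵁ_ {xs = xs} r {xs′} r′ =
  Run-resp (sym (uncut-++ xs xs′)) (r ++ᴿ r′)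

Positive : List ℕ → Set
Positive = All (1 ≤_)

inner-run : Positive ys → Run inner (uncut (ys ∷ʳ suc (suc x))) (decLast (ys ∷ʳ suc (suc x))) done
inner-run []                          = cons same (closes _) []
inner-run (s≤s _ ∷ [])                = cons same (runs _) (inner-run [])
inner-run (s≤s _ ∷ pos@(_ ∷ _))       = cons same (runs _) (inner-run pos)

p2-∷ʳ : ∀ y ys z → p2 (y ∷ (ys ∷ʳ z)) ≡ suc y ∷ decLast (ys ∷ʳ z)
p2-∷ʳ y []       z = refl
p2-∷ʳ y (_ ∷ ys) z = refl

-- With the trailing ones split off, B′ ends in an entry that is at least 2. Alone it is read by
-- `single`; otherwise it is what `closes` needs.
p2-run : Positive ys → Run start (uncut (ys ∷ʳ suc (suc x))) (p2 (ys ∷ʳ suc (suc x))) done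
p2-run [] = cons same (single _) []
p2-run {ys = suc y ∷ ys} {x} (s≤s _ ∷ pos) rewrite p2-∷ʳ (suc y) ys (suc (suc x)) =
  cons same (opens _) (inner-run pos)

tail-run : ∀ k → Idle s → Run s (uncut (replicate k 1 ∷ʳ 0)) (0 ∷ replicate k 1) start
tail-run k idle = first k (toDone idle)
  where
  toDone : Idle s → Link false s done
  toDone start = empty
  toDone done  = same

  rest : ∀ k → Run ones (uncut (replicate k 1 ∷ʳ 0)) (1 ∷ replicate k 1) start
  rest zero    = cons same tail-closes []
  rest (suc k) = cons same tail-runs (rest k)

  first : ∀ k → Link false s done → Run s (uncut (replicate k 1 ∷ʳ 0)) (0 ∷ replicate k 1) start
  first zero    l = cons l zero-stays []
  first (suc k) l = cons l tail-opens (rest k)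

Positive-reverse : ∀ {xs} → Positive xs → Positive (reverse xs)
Positive-reverse [] = []
Positive-reverse {x ∷ xs} (p ∷ ps) = subst Positive (sym (unfold-reverse x xs)) (∷ʳ⁺ (Positive-reverse ps) p)

replicate-∷ʳ : ∀ k (x : ℕ) → replicate (suc k) x ≡ replicate k x ∷ʳ x
replicate-∷ʳ zero    x = refl
replicate-∷ʳ (suc k) x = cong (x ∷_) (replicate-∷ʳ k x)

reverse-replicate : ∀ k (x : ℕ) → reverse (replicate k x) ≡ replicate k x
reverse-replicate zero    x = refl
reverse-replicate (suc k) x =
  trans (unfold-reverse x (replicate k x))
    (trans (cong (_∷ʳ x) (reverse-replicate k x)) (sym (replicate-∷ʳ k x)))

spanOnes-spec : ∀ {xs} → Positive xs → ∃ λ k → ∃ λ ys → spanOnes xs ≡ (replicate k 1 , ys) ×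
  xs ≡ replicate k 1 ++ ys × (ys ≡ [] ⊎ ∃ λ y → ∃ λ ys′ → ys ≡ suc (suc y) ∷ ys′)
spanOnes-spec [] = 0 , [] , refl , refl , inj₁ refl
spanOnes-spec {suc zero ∷ xs} (_ ∷ pos) with spanOnes-spec pos
... | k , ys , eq , refl , tl rewrite eq = suc k , ys , refl , refl , tl
spanOnes-spec {suc (suc x) ∷ xs} (_ ∷ pos) = 0 , _ , refl , refl , inj₂ (x , xs , refl)

splitBlock-run : ∀ {acc} → Positive acc → ∃ λ k → ∃ λ B → ∃ λ B″ → ∃ λ s →
  splitBlock acc ≡ (B″ , replicate k 1) × reverse acc ≡ B ++ replicate k 1 ×
  Idle s × Run start (uncut B) B″ s
splitBlock-run pos with spanOnes-spec pos
splitBlock-run pos | k , .[] , eq , refl , inj₁ refl rewrite eq =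
  k , [] , [] , start , refl ,
  trans (cong reverse (++-identityʳ (replicate k 1))) (reverse-replicate k 1) , start , []
splitBlock-run pos | k , .(suc (suc y) ∷ ys) , eq , refl , inj₂ (y , ys , refl) rewrite eq =
  k , reverse (suc (suc y) ∷ ys) , _ , done , refl ,
  trans (reverse-++ (replicate k 1) (suc (suc y) ∷ ys))
        (cong (reverse (suc (suc y) ∷ ys) ++_) (reverse-replicate k 1)) ,
  done , body (++⁻ʳ (replicate k 1) pos)
  where
  body : Positive (suc (suc y) ∷ ys) →
    Run start (uncut (reverse (suc (suc y) ∷ ys))) (p2 (reverse (suc (suc y) ∷ ys))) done
  body (_ ∷ pos′) rewrite unfold-reverse (suc (suc y)) ys = p2-run (Positive-reverse pos′)

flushZero-run : ∀ {acc} → Positive acc → Run start (uncut (reverse acc ∷ʳ 0)) (flushZero acc) start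
flushZero-run {acc} pos with splitBlock-run pos
... | k , B , B″ , s , eq , rev , idle , r
  rewrite cong (λ p → proj₁ p ++ 0 ∷ proj₂ p) eq | rev | ++-assoc B (replicate k 1) (0 ∷ []) =
  r ++ᵁ tail-run k idle

-- Reading a 1 never leads to an idle state, so no run that may stop at a cut ends with one. This
-- excludes the trailing ones that `flushEnd` leaves in place.
NoOneLast : List ℕ → Set
NoOneLast xs = ∀ ys → xs ≢ ys ∷ʳ 1

IdleRun : List (Bool × ℕ) → List ℕ → Set
IdleRun zs ys = ∃ λ s → Idle s × Run start zs ys s

flushEnd-run : ∀ {acc} → Positive acc → NoOneLast (reverse acc) → IdleRun (uncut (reverse acc)) (flushEnd acc)
flushEnd-run {acc} pos last with splitBlock-run pos
... | suc k , B , B″ , s , eq , rev , idle , r =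
  ⊥-elim (last (B ++ replicate k 1)
    (trans rev (trans (cong (B ++_) (replicate-∷ʳ k 1)) (sym (++-assoc B (replicate k 1) (1 ∷ []))))))
... | zero , B , B″ , s , eq , rev , idle , r
  rewrite cong (λ p → proj₁ p ++ proj₂ p) eq | rev | ++-identityʳ B | ++-identityʳ B″ =
  s , idle , r

φgo-run : ∀ {acc} → Positive acc → ∀ xs → NoOneLast (reverse acc ++ xs) →
          IdleRun (uncut (reverse acc ++ xs)) (φgo acc xs)
φgo-run {acc} pos [] last rewrite ++-identityʳ (reverse acc) = flushEnd-run pos last
φgo-run {acc} pos (zero ∷ xs) last
  with φgo-run [] xs (λ ys eq → last (reverse acc ++ 0 ∷ ys)
         (trans (cong (λ l → reverse acc ++ 0 ∷ l) eq) (sym (++-assoc (reverse acc) (0 ∷ ys) (1 ∷ [])))))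
... | s , idle , r rewrite sym (∷ʳ-++ (reverse acc) 0 xs) = s , idle , (flushZero-run pos ++ᵁ r)
φgo-run {acc} pos (suc k ∷ xs) last =
  subst (λ l → IdleRun (uncut l) (φgo (suc k ∷ acc) xs)) eq
    (φgo-run (s≤s z≤n ∷ pos) xs (subst NoOneLast (sym eq) last))
  where
  eq : reverse (suc k ∷ acc) ++ xs ≡ reverse acc ++ suc k ∷ xs
  eq = trans (cong (_++ xs) (unfold-reverse (suc k) acc)) (∷ʳ-++ (reverse acc) (suc k) xs)

φ-run : ∀ xs → NoOneLast xs → IdleRun (uncut xs) (φ xs)
φ-run = φgo-run []

-- Chain v zs w: no cut of zs comes right after a 1, where v is the entry before zs and w
-- the last one.
data Chain : ℕ → List (Bool × ℕ) → ℕ → Set where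
  []   : Chain v [] v
  cons : (c ≡ true → v ≢ 1) → Chain x zs w → Chain v ((c , x) ∷ zs) w

_++ᶜ_ : Chain v zs w → Chain w zs′ x → Chain v (zs ++ zs′) x
[]       ++ᶜ r′ = r′
cons p r ++ᶜ r′ = cons p (r ++ᶜ r′)

splitᶜ : ∀ zs {zs′} → Chain v (zs ++ zs′) w → ∃ λ x → Chain v zs x × Chain x zs′ w
splitᶜ []       r = _ , [] , r
splitᶜ (z ∷ zs) (cons p r) with splitᶜ zs r
... | x , r₁ , r₂ = x , cons p r₁ , r₂

-- Across a cut the next state may be chosen anew among the idle ones, so each factor can be run
-- from `start` on its own and attached afterwards.
recut : Idle s → Run start ((false , x) ∷ zs) ys τ → Run s ((true , x) ∷ zs) ys τ
recut idle (cons same  p r) = cons (cut idle start) p r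
recut idle (cons empty p r) = cons (cut idle done) p r

cutGo-run : ∀ v acc zs → Chain v zs w → w ≢ 1 →
            IdleRun (uncut (reverse (v ∷ acc)) ++ zs) (cutGo (v ∷ acc) zs)
cutGo-run v acc zs ch w≢1 = go zs ch
  where
  block : v ≢ 1 → IdleRun (uncut (reverse (v ∷ acc))) (φ (reverse (v ∷ acc)))
  block v≢1 = φ-run (reverse (v ∷ acc)) λ ys eq →
    v≢1 (∷ʳ-injectiveʳ (reverse acc) ys (trans (sym (unfold-reverse v acc)) eq))

  go : ∀ zs → Chain v zs _ → IdleRun (uncut (reverse (v ∷ acc)) ++ zs) (cutGo (v ∷ acc) zs)
  go [] [] rewrite ++-identityʳ (uncut (reverse (v ∷ acc))) = block w≢1
  go ((true , x) ∷ zs) (cons ok ch)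
    with block (ok refl) | cutGo-run x [] zs ch w≢1
  ... | s , idle , r | τ , idle′ , r′ = τ , idle′ , (r ++ᴿ recut idle r′)
  go ((false , x) ∷ zs) (cons _ ch) =
    subst (λ l → IdleRun l (cutGo (x ∷ v ∷ acc) zs)) eq (cutGo-run x (v ∷ acc) zs ch w≢1)
    where
    eq : uncut (reverse (x ∷ v ∷ acc)) ++ zs ≡ uncut (reverse (v ∷ acc)) ++ (false , x) ∷ zs
    eq = trans (cong (λ l → uncut l ++ zs) (unfold-reverse x (v ∷ acc)))
        (trans (cong (_++ zs) (uncut-++ (reverse (v ∷ acc)) (x ∷ [])))
               (∷ʳ-++ (uncut (reverse (v ∷ acc))) (false , x) zs))

-- Runs of `φ` begin in `start`, and reading a 0 ends there. For this reason a rotation that puts a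
-- 0 last closes the run.
zero-last : ∀ xs → Run s (uncut (xs ∷ʳ 0)) ys τ → τ ≡ start
zero-last []       (cons _ zero-stays  []) = refl
zero-last []       (cons _ tail-closes []) = refl
zero-last (x ∷ xs) (cons _ _ r) = zero-last xs r

firstIndex-zero : ∀ d → allL (1 ≤ᵇ_) d ≡ false →
  ∃ λ xs → ∃ λ ys → d ≡ xs ++ 0 ∷ ys × firstIndex isZero d ≡ length xs
firstIndex-zero (zero  ∷ d) _  = [] , d , refl , refl
firstIndex-zero (suc x ∷ d) eq with firstIndex-zero d eq
... | xs , ys , p , q = suc x ∷ xs , ys , cong (suc x ∷_) p , cong suc q

-- Without a 0 no segment can end, so the whole circle counts as the inside of one B′, on which
-- nothing changes.
positive-run : ∀ d → allL (1 ≤ᵇ_) d ≡ true → Run inner (uncut d) d inner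
positive-run []          _  = []
positive-run (suc x ∷ d) eq = cons same (runs x) (positive-run d eq)

rotate-back : ∀ {A : Set} (xs ys : List A) → length (xs ++ ys) ∸ length xs ≡ length ys
rotate-back xs ys = trans (cong (_∸ length xs) (length-++ xs)) (m+n∸m≡n (length xs) (length ys))

φ-rotate-run : ∀ xs ys {d k} → d ≡ (xs ∷ʳ 0) ++ ys → k ≡ length (xs ∷ʳ 0) →
               ∃ λ s → Run s (uncut d) (rotate (length d ∸ k) (φ (rotate k d))) s
φ-rotate-run xs ys refl refl with φ-run (ys ++ (xs ∷ʳ 0))
  (λ zs eq → 0≢1+n (∷ʳ-injectiveʳ (ys ++ xs) zs (trans (++-assoc ys xs (0 ∷ [])) eq)))
... | s , _ , r with zero-last (ys ++ xs) (Run-resp (cong uncut (sym (++-assoc ys xs (0 ∷ [])))) r)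
... | refl
  rewrite rotate-length (xs ∷ʳ 0) ys 
        | trans (rotate-back (xs ∷ʳ 0) ys) (sym (length-map {B = Bool × ℕ} (false ,_) ys))
        | uncut-++ (xs ∷ʳ 0) ys
  = rotateᴿ (uncut (xs ∷ʳ 0)) (uncut ys)
      (Run-resp (uncut-++ ys (xs ∷ʳ 0)) r)

φ̄-run : ∀ d → ∃ λ s → Run s (uncut d) (φ̄ d) s
φ̄-run d with allL (1 ≤ᵇ_) d in all
... | true  = inner , positive-run d all
... | false with firstIndex-zero d all
...   | xs , ys , eq , idx = φ-rotate-run xs ys (trans eq (sym (∷ʳ-++ xs 0 ys)))
          (trans (cong suc idx) (trans (+-comm 1 (length xs)) (sym (length-++ xs))))

zip-uncut : ∀ cuts d → length cuts ≡ length d → anyL (λ b → b) cuts ≡ false → zip cuts d ≡ uncut d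
zip-uncut []             []      _   _  = refl
zip-uncut (false ∷ cuts) (x ∷ d) len eq = cong ((false , x) ∷_) (zip-uncut cuts d (cong (_∸ 1) len) eq)

firstIndex-cut : ∀ cuts (d : List ℕ) → length cuts ≡ length d → anyL (λ b → b) cuts ≡ true →
  ∃ λ zs → ∃ λ x → ∃ λ zs′ →
    zip cuts d ≡ zs ++ (true , x) ∷ zs′ × firstIndex (λ b → b) cuts ≡ length zs
firstIndex-cut (true  ∷ cuts) (x ∷ d) _   _  = [] , x , zip cuts d , refl , refl
firstIndex-cut (false ∷ cuts) (y ∷ d) len eq with firstIndex-cut cuts d (cong (_∸ 1) len) eq
... | zs , x , zs′ , p , q = (false , y) ∷ zs , x , zs′ , cong ((false , y) ∷_) p , cong suc q

length-zip : ∀ (cuts : List Bool) (d : List ℕ) → length cuts ≡ length d → length d ≡ length (zip cuts d)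
length-zip []         []      _   = refl
length-zip (_ ∷ cuts) (_ ∷ d) len = cong suc (length-zip cuts d (cong (_∸ 1) len))

cutGo-rotate-run : ∀ zs zs′ {zs″ k} → zs″ ≡ zs ++ (true , x) ∷ zs′ → k ≡ length zs → Chain v zs″ v →
  ∃ λ s → Run s zs″ (rotate (length zs″ ∸ k) (cutGo [] (rotate k zs″))) s
cutGo-rotate-run {x} zs zs′ refl refl ch with splitᶜ zs ch
-- The chain is closed and can be reopened at the first cut; the condition `ok` at this cut then
-- concerns the last entry of the last factor.
... | w , ch₁ , cons ok ch₂ with cutGo-run x [] (zs′ ++ zs) (ch₂ ++ᶜ ch₁) (ok refl)
... | s , idle , r
  rewrite rotate-length zs ((true , x) ∷ zs′) | rotate-back zs ((true , x) ∷ zs′) =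
  rotateᴿ zs ((true , x) ∷ zs′) (recut idle r)

phc2-run : ∀ cuts d → length cuts ≡ length d → Chain v (zip cuts d) v →
           ∃ λ s → Run s (zip cuts d) (phc2 cuts d) s
phc2-run cuts d len ch with anyL (λ b → b) cuts in any
... | false rewrite zip-uncut cuts d len any = φ̄-run d
... | true  rewrite length-zip cuts d len with firstIndex-cut cuts d len any
...   | zs , x , zs′ , eq , idx = cutGo-rotate-run zs zs′ eq idx ch

chain-tabulate : ∀ {ℓ} (cuts : Fin ℓ → Bool) (d : Fin (suc ℓ) → ℕ) →
  (∀ i → cuts i ≡ true → d (inject₁ i) ≢ 1) →
  Chain (d zero) (tabulate (λ i → cuts i , d (suc i))) (d (fromℕ ℓ))
chain-tabulate {zero}  cuts d ok = []
chain-tabulate {suc ℓ} cuts d ok =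
  cons (ok zero) (chain-tabulate (λ i → cuts (suc i)) (λ i → d (suc i)) (λ i → ok (suc i)))

run-tabulate : ∀ {ℓ} (cuts : Fin ℓ → Bool) (d : Fin ℓ → ℕ) {es s τ} →
  Run s (tabulate (λ i → cuts i , d i)) es τ →
  Σ (Fin ℓ → State) λ inn → Σ (Fin (suc ℓ) → State) λ st → st zero ≡ s × st (fromℕ ℓ) ≡ τ ×
    (∀ i → Link (cuts i) (st (inject₁ i)) (inn i) × Step (inn i) (d i) (lookupL es (toℕ i)) (st (suc i)))
run-tabulate {zero} cuts d {s = s} [] = (λ ()) , (λ _ → s) , refl , refl , λ ()
run-tabulate {suc ℓ} cuts d {s = s} (cons {s′ = s′} l p r)
  with run-tabulate (λ i → cuts (suc i)) (λ i → d (suc i)) r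
... | inn , st , refl , end , ok =
  (λ { zero → s′ ; (suc i) → inn i }) , (λ { zero → s ; (suc i) → st i }) , refl , end ,
  (λ { zero → l , p ; (suc i) → ok i })

zip-tabulate : ∀ {ℓ} {A B : Set} (f : Fin ℓ → A) (g : Fin ℓ → B) →
               zip (tabulate f) (tabulate g) ≡ tabulate (λ i → f i , g i)
zip-tabulate {zero}  f g = refl
zip-tabulate {suc ℓ} f g = cong (_ ∷_) (zip-tabulate (λ i → f (suc i)) (λ i → g (suc i)))

phc2-isRun : ∀ {ℓ} (cuts : Fin ℓ → Bool) (d : Fin ℓ → ℕ) →
  (∀ i → cuts i ≡ true → d (prevFin i) ≢ 1) →
  IsRun prevFin cuts d (λ i → lookupL (phc2 (tabulate cuts) (tabulate d)) (toℕ i))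
phc2-isRun {zero} cuts d ok =
  record { inn = λ () ; out = λ () ; link = λ () ; step = λ () }
phc2-isRun {suc m} cuts d ok
  with phc2-run (tabulate cuts) (tabulate d)
         (trans (length-tabulate cuts) (sym (length-tabulate d)))
         (subst (λ l → Chain (d (fromℕ m)) l (d (fromℕ m))) (sym (zip-tabulate cuts d))
           -- The last entry is repeated in front, as the cyclic predecessor of the first.
           (chain-tabulate cuts (λ { zero → d (fromℕ m) ; (suc i) → d i })
             (λ { zero → ok zero ; (suc i) → ok (suc i) })))
... | s , r with run-tabulate cuts d (Run-resp (zip-tabulate cuts d) r)
...   | inn , st , begins , ends , ok′ = record
  { inn  = inn
  ; out  = λ i → st (suc i)
  ; link = λ { zero    → subst (λ o → Link (cuts zero) o (inn zero)) (trans begins (sym ends)) (proj₁ (ok′ zero))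
             ; (suc i) → proj₁ (ok′ (suc i)) }
  ; step = λ i → proj₂ (ok′ i)
  }

-- The same list computation serves the reversed circle: it is applied to the families read
-- backwards, and `opposite` turns the step to the previous index into the step to the next.
exists-run-opp : ∀ {ℓ} (cuts : Fin ℓ → Bool) (d : Fin ℓ → ℕ) →
  (∀ i → cuts i ≡ true → d (nextFin i) ≢ 1) → ∃ (IsRun nextFin cuts d)
exists-run-opp cuts d ok = e , record
  { inn  = λ i → inn (opposite i)
  ; out  = λ i → out (opposite i)
  ; link = λ i → subst₂ (λ j k → Link (cuts j) (out k) (inn (opposite i)))
                   (opposite-involutive i) (back i) (link (opposite i))
  ; step = λ i → subst (λ j → Step (inn (opposite i)) (d j) (e i) (out (opposite i)))
                   (opposite-involutive i) (step (opposite i))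
  }
  where
  e = λ i → lookupL (phc2 (tabulate (cuts ∘ opposite)) (tabulate (d ∘ opposite))) (toℕ (opposite i))

  open IsRun (phc2-isRun (cuts ∘ opposite) (d ∘ opposite)
    (λ i c → subst (λ j → d j ≢ 1) (sym (opposite-prev i)) (ok (opposite i) c)))

  back : ∀ i → prevFin (opposite i) ≡ opposite (nextFin i)
  back i = trans (sym (opposite-involutive (prevFin (opposite i))))
             (cong opposite (trans (opposite-prev (opposite i)) (cong nextFin (opposite-involutive i))))

-- Codes of ideals and filters

-- The last hypothesis excludes a positive `a` over an empty `d`, a pair that would collide with the
-- result of a move.
slide-down : ∀ f a d → a ≤ f → (1 ≤ a → 1 ≤ d) → let c = (d ≡ᵇ 1) ∧ (a <ᵇ f) in
             Slide f a d (if c then suc a else a) (if c then 0 else d)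
slide-down f zero    zero          _   _   = none
slide-down f (suc a) zero          _   sup with sup (s≤s z≤n)
... | ()
slide-down f a       (suc zero)    a≤f _ with a <ᵇ f in eq
... | true  = moved (<ᵇ≡true⇒< a f eq)
... | false with ≤-antisym a≤f (<ᵇ≡false⇒≥ a f eq)
...   | refl = full
slide-down f a       (suc (suc d)) a≤f _ = large a≤f

-- A 1 beside an Ã that is not full would be left alone here but moved by `slide-down`; the last
-- hypothesis rules it out.
slide-up : ∀ f a d → a ≤ f → (d ≡ 1 → a ≡ f) → let c = isZero d ∧ (1 ≤ᵇ a) in
           Slide f (if c then a ∸ 1 else a) (if c then 1 else d) a d
slide-up f zero    zero          _   _ = none
slide-up f (suc a) zero          a<f _ = moved a<f
slide-up f a       (suc zero)    _   p with p refl
... | refl = full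
slide-up f a       (suc (suc d)) a≤f _ = large a≤f

slide-code : ∀ {f a d a′ d′} → Slide f a d a′ d′ → a ≤ f × (1 ≤ a → 1 ≤ d)
slide-code none      = z≤n , λ ()
slide-code (moved p) = <⇒≤ p , λ _ → s≤s z≤n
slide-code full      = ≤-refl , λ _ → s≤s z≤n
slide-code (large p) = p , λ _ → s≤s z≤n

-- Only `full` leaves a 1 behind. Since cuts mark the Ã that are not full, no factor ends in 1.
slide-one : ∀ {f a d a′ d′} → Slide f a d a′ d′ → (a′ <ᵇ f) ≡ true → d′ ≢ 1
slide-one {f} full lt refl = <-irrefl refl (<ᵇ≡true⇒< f f lt)

-- From `start` the output is at least 2, from `done` it is 0. Applied to a run and to its mirror,
-- this keeps ones away from both sides of a cut.
idle-in : ∀ {s x y t} → Idle s → Step s x y t → y ≢ 1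
idle-in start (single _) ()
idle-in start (opens _)  ()
idle-in done  zero-stays ()
idle-in done  tail-opens ()

module _ {ℓ} {pv : Fin ℓ → Fin ℓ} {cuts : Fin ℓ → Bool} {d e : Fin ℓ → ℕ} (r : IsRun pv cuts d e) where
  open IsRun r

  run-one-out : ∀ i → e i ≡ 1 → cuts i ≡ false
  run-one-out i e≡1 with cuts i | link i
  ... | false | _       = refl
  ... | true  | cut _ p = ⊥-elim (idle-in p (step i) e≡1)

  run-one-in : ∀ i → d (pv i) ≡ 1 → cuts i ≡ false
  run-one-in i d≡1 with cuts i | link i
  ... | false | _       = refl
  ... | true  | cut p _ = ⊥-elim (idle-in (mirror-idle p) (mirror-step (step (pv i))) d≡1)

module _ {ℓ} (f δ : Fin ℓ → ℕ) where

  record IdealCode (a d : Fin ℓ → ℕ) : Set where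
    field
      bound   : ∀ i → a i ≤ f i
      support : ∀ i → 1 ≤ a i → 1 ≤ d (prevFin i)
      top     : Top prevFin f δ a d

  record FilterCode (b e : Fin ℓ → ℕ) : Set where
    field
      bound   : ∀ i → b i ≤ f i
      support : ∀ i → 1 ≤ b i → 1 ≤ e i
      top     : Top nextFin (f ∘ nextFin) δ (b ∘ nextFin) e

  module _ (1≤δ : ∀ i → 1 ≤ δ i) {a d b e : Fin ℓ → ℕ} (r : Rel prevFin f a d b e) where
    open Rel r

    rel-filterCode : IdealCode a d → FilterCode b e
    rel-filterCode ic = record
      { bound   = λ i → proj₁ (slide-code (slide₃ i))
      ; support = λ i → proj₂ (slide-code (slide₃ i))
      ; top     = rel-top (circle ℓ) 1≤δ r (IdealCode.top ic)
      }

    rel-idealCode : FilterCode b e → IdealCode a d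
    rel-idealCode fc = record
      { bound   = λ i → proj₁ (slide-code (slide₁ i))
      ; support = λ i → proj₂ (slide-code (slide₁ i))
      ; top     = λ i → subst (λ j → d i ≤ δ i ⊎ (d i ≡ suc (δ i) × a j ≡ f j × 1 ≤ d (prevFin i)))
                          (next-prev i)
                          (rel-top (opp (circle ℓ)) 1≤δ (mirror-rel (circle ℓ) r) (FilterCode.top fc) i)
      }

  rel-cong : ∀ {pv} {a d a′ d′ b e b′ e′ : Fin ℓ → ℕ} → (∀ i → a i ≡ a′ i) → (∀ i → d i ≡ d′ i) →
    (∀ i → b i ≡ b′ i) → (∀ i → e i ≡ e′ i) → Rel pv f a d b e → Rel pv f a′ d′ b′ e′
  rel-cong {pv} a≗ d≗ b≗ e≗ r = record
    { m = m ; d₁ = d₁ ; e₁ = e₁ ; run = run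
    ; slide₁ = λ i → subst₂ (λ x y → Slide (f i) x y (m i) (d₁ (pv i))) (a≗ i) (d≗ (pv i)) (slide₁ i)
    ; slide₃ = λ i → subst₂ (λ x y → Slide (f i) x y (m i) (e₁ i)) (b≗ i) (e≗ i) (slide₃ i)
    }
    where open Rel r

  rel-injective : ∀ {a d a′ d′ b e b′ e′} → (∀ i → b i ≡ b′ i) → (∀ i → e i ≡ e′ i) →
    Rel prevFin f a d b e → Rel prevFin f a′ d′ b′ e′ → ∀ i → a i ≡ a′ i × d i ≡ d′ i
  rel-injective {a} {d} {a′} {d′} b≗ e≗ r r′ i =
    subst (λ j → a j ≡ a′ j) (next-prev i) (proj₁ (both (prevFin i))) , proj₂ (both i)
    where
    both : ∀ i → a (nextFin i) ≡ a′ (nextFin i) × d i ≡ d′ i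
    both = rel-functional (opp (circle ℓ)) (mirror-rel (circle ℓ) r) 
             (mirror-rel (circle ℓ) (rel-cong (λ _ → refl) (λ _ → refl) (λ i → sym (b≗ i)) (λ i → sym (e≗ i)) r′))

  -- The three steps are carried out on the reversed circle, starting from the filter code;
  -- mirroring the run obtained there gives the desired preimage.
  rel-surjective : ∀ {b e} → FilterCode b e → ∃ λ a → ∃ λ d → Rel prevFin f a d b e
  rel-surjective {b} {e} fc = a , d , record
    { m = m ; d₁ = d₁ ; e₁ = e₁ ; run = run ; slide₃ = slide₃
    -- The condition in `d (prevFin i)` refers to `nextFin (prevFin i)` and the one in `a i` to `i`;
    -- only the former is transported.
    ; slide₁ = λ i → subst (λ j → let c = isZero (d₁ (prevFin i)) ∧ (1 ≤ᵇ m j) in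
                         Slide (f i) (a i) (if c then 1 else d₁ (prevFin i)) (m i) (d₁ (prevFin i)))
                       (sym (next-prev i))
                       (slide-up (f i) (m i) (d₁ (prevFin i)) (slide-≤-capacity (slide₃ i))
                         (λ d≡1 → ≤-antisym (slide-≤-capacity (slide₃ i))
                           (<ᵇ≡false⇒≥ (m i) (f i) (run-one-in run i d≡1))))
    }
    where
    open FilterCode fc

    down up : Fin ℓ → Bool
    down i = (e i ≡ᵇ 1) ∧ (b i <ᵇ f i)

    m e₁ a d d₁ : Fin ℓ → ℕ
    m  i = if down i then suc (b i) else b i
    e₁ i = if down i then 0 else e i

    slide₃ : ∀ i → Slide (f i) (b i) (e i) (m i) (e₁ i)
    slide₃ i = slide-down (f i) (b i) (e i) (bound i) (support i)

    back : ∃ (IsRun nextFin (λ i → m (nextFin i) <ᵇ f (nextFin i)) e₁)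
    back = exists-run-opp _ e₁ (λ i → slide-one (slide₃ (nextFin i)))

    d₁ = proj₁ back

    run : IsRun prevFin (λ i → m i <ᵇ f i) d₁ e₁
    run = run-cong (λ i → cong (λ j → m j <ᵇ f j) (next-prev i)) (λ _ → refl) (λ _ → refl)
            (mirror-run (opp (circle ℓ)) (proj₂ back))

    up i = isZero (d₁ (prevFin i)) ∧ (1 ≤ᵇ m i)
    a i  = if up i then m i ∸ 1 else m i
    d i  = if isZero (d₁ i) ∧ (1 ≤ᵇ m (nextFin i)) then 1 else d₁ i

module _ {ℓ} (α δ : Fin ℓ → ℕ) where
  open Fence ℓ α δ

  Φ̄-rel : ∀ I → IdealCode (λ i → α i ∸ 1) δ (encA I) (encD I) →
          Rel prevFin (λ i → α i ∸ 1) (encA I) (encD I) (b₃ I) (e₃ I)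
  Φ̄-rel I ic = record
    { m = a₁ I ; d₁ = d₁ I ; e₁ = e₂ I ; slide₁ = slide₁ ; run = run
    ; slide₃ = λ i → slide-up (α i ∸ 1) (a₁ I i) (e₂ I i) (slide-≤-capacity (slide₁ i))
        (λ e≡1 → ≤-antisym (slide-≤-capacity (slide₁ i))
          (<ᵇ≡false⇒≥ (a₁ I i) (α i ∸ 1) (run-one-out run i e≡1)))
    }
    where
    open IdealCode ic

    slide₁ : ∀ i → Slide (α i ∸ 1) (encA I i) (encD I (prevFin i)) (a₁ I i) (d₁ I (prevFin i))
    slide₁ i = subst (λ j → let c = (encD I (prevFin i) ≡ᵇ 1) ∧ (encA I j <ᵇ α j ∸ 1) in
                   Slide (α i ∸ 1) (encA I i) (encD I (prevFin i))
                     (if c then suc (encA I i) else encA I i) (if c then 0 else encD I (prevFin i)))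
                 (sym (next-prev i))
                 (slide-down (α i ∸ 1) (encA I i) (encD I (prevFin i)) (bound i) (support i))

    run : IsRun prevFin (λ i → a₁ I i <ᵇ α i ∸ 1) (d₁ I) (e₂ I)
    run = phc2-isRun _ (d₁ I) (λ i → slide-one (slide₁ i))

-- Counting and prefix sums

Bool-ext : ∀ {b c} → (b ≡ true → c ≡ true) → (c ≡ true → b ≡ true) → b ≡ c
Bool-ext {true}  {true}  _ _ = refl
Bool-ext {true}  {false} f _ = sym (f refl)
Bool-ext {false} {true}  _ g = g refl
Bool-ext {false} {false} _ _ = refl

<ᵇ-mono : ∀ {i j k l} → j ≤ i → k ≤ l → (i <ᵇ k) ≡ true → (j <ᵇ l) ≡ true
<ᵇ-mono {i} {k = k} j≤i k≤l eq = <⇒<ᵇ≡true (<-≤-trans (≤-<-trans j≤i (<ᵇ≡true⇒< i k eq)) k≤l)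

≤⇒≤ᵇ≡true : ∀ {m n} → m ≤ n → (m ≤ᵇ n) ≡ true
≤⇒≤ᵇ≡true z≤n       = refl
≤⇒≤ᵇ≡true p@(s≤s _) = <⇒<ᵇ≡true p

≤ᵇ≡true⇒≤ : ∀ m n → (m ≤ᵇ n) ≡ true → m ≤ n
≤ᵇ≡true⇒≤ zero    n _  = z≤n
≤ᵇ≡true⇒≤ (suc m) n eq = <ᵇ≡true⇒< m n eq

anyFin⁻ : ∀ {m} (f : Fin m → Bool) → anyFin f ≡ true → ∃ λ i → f i ≡ true
anyFin⁻ {suc m} f eq with f zero in f0
... | true  = zero , f0
... | false with anyFin⁻ (λ i → f (suc i)) eq
...   | i , p = suc i , p

anyFin⁺ : ∀ {m} (f : Fin m → Bool) i → f i ≡ true → anyFin f ≡ true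
anyFin⁺ f zero    p rewrite p = refl
anyFin⁺ f (suc i) p rewrite anyFin⁺ (λ j → f (suc j)) i p = ∨-zeroʳ (f zero)

indicator : Bool → ℕ
indicator b = if b then 1 else 0

countBelow-cong : ∀ {f g} m → (∀ k → k < m → f k ≡ g k) → countBelow f m ≡ countBelow g m
countBelow-cong zero    eq = refl
countBelow-cong (suc m) eq =
  cong₂ _+_ (countBelow-cong m (λ k k<m → eq k (m<n⇒m<1+n k<m))) (cong indicator (eq m ≤-refl))

countBelow-+ : ∀ f m k → countBelow f (m + k) ≡ countBelow f m + countBelow (λ j → f (m + j)) k
countBelow-+ f m zero rewrite +-identityʳ m = sym (+-identityʳ _)
countBelow-+ f m (suc k) rewrite +-suc m k | countBelow-+ f m k =
  +-assoc (countBelow f m) (countBelow (λ j → f (m + j)) k) _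

countBelow-≤ : ∀ f m → countBelow f m ≤ m
countBelow-≤ f zero = z≤n
countBelow-≤ f (suc m) with f m
... | true  = ≤-trans (+-monoˡ-≤ 1 (countBelow-≤ f m)) (≤-reflexive (+-comm m 1))
... | false = ≤-trans (≤-reflexive (+-identityʳ _)) (m≤n⇒m≤1+n (countBelow-≤ f m))

countBelow-initial : ∀ {f} m c → c ≤ m → (∀ k → k < m → f k ≡ (k <ᵇ c)) → countBelow f m ≡ c
countBelow-initial zero    zero _   _  = refl
countBelow-initial {f} (suc m) c c≤m eq with m≤n⇒m<n∨m≡n c≤m
... | inj₁ (s≤s c≤m′) rewrite eq m ≤-refl | ≥⇒<ᵇ≡false c≤m′ =
  trans (+-identityʳ _) (countBelow-initial m c c≤m′ (λ k k<m → eq k (m<n⇒m<1+n k<m)))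
... | inj₂ refl rewrite eq m ≤-refl | <⇒<ᵇ≡true (≤-refl {suc m}) =
  trans (cong (_+ 1) (countBelow-initial m m ≤-refl
          (λ k k<m → trans (eq k (m<n⇒m<1+n k<m)) (trans (<⇒<ᵇ≡true (m<n⇒m<1+n k<m)) (sym (<⇒<ᵇ≡true k<m))))))
        (+-comm m 1)

∸-suc : ∀ {m k} → k < m → m ∸ k ≡ suc (m ∸ suc k)
∸-suc {suc m} {zero}  _       = refl
∸-suc {suc m} {suc k} (s≤s p) = ∸-suc p

countBelow-final : ∀ {f} m c → c ≤ m → (∀ k → k < m → f k ≡ (m ∸ suc k <ᵇ c)) → countBelow f m ≡ c
countBelow-final zero zero _ _ = refl
countBelow-final {f} (suc m) zero c≤m eq
  rewrite eq m ≤-refl =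
  trans (+-identityʳ _) (countBelow-final m zero z≤n (λ k k<m → eq k (m<n⇒m<1+n k<m)))
countBelow-final {f} (suc m) (suc c) (s≤s c≤m) eq rewrite eq m ≤-refl | n∸n≡0 m =
  trans (cong (_+ 1) (countBelow-final m c c≤m
          (λ k k<m → trans (eq k (m<n⇒m<1+n k<m)) (cong (_<ᵇ suc c) (∸-suc k<m)))))
        (+-comm c 1)

initial-countBelow : ∀ f m → (∀ k → suc k < m → f (suc k) ≡ true → f k ≡ true) →
                     ∀ k → k < m → f k ≡ (k <ᵇ countBelow f m)
initial-countBelow f (suc m) dec k k<m with f m in fm
... | true = trans (all k k<m)
               (sym (<⇒<ᵇ≡true (subst (k <_) (sym (trans (cong (_+ 1) count) (+-comm m 1))) k<m)))
  where
  all : ∀ k → k < suc m → f k ≡ true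
  all k (s≤s k≤m) = down (m ∸ k) k (m∸n+n≡m k≤m)
    where
    down : ∀ j k → j + k ≡ m → f k ≡ true
    down zero    k refl = fm
    down (suc j) k eq   = dec k (s≤s (subst (suc k ≤_) eq (s≤s (m≤n+m k j)))) (down j (suc k) (trans (+-suc j k) eq))
  count : countBelow f m ≡ m
  count = countBelow-initial m m ≤-refl
            (λ k k<m → trans (all k (m<n⇒m<1+n k<m)) (sym (<⇒<ᵇ≡true k<m)))
... | false rewrite +-identityʳ (countBelow f m) with m≤n⇒m<n∨m≡n k<m
...   | inj₁ (s≤s k<m′) = initial-countBelow f m (λ j j<m → dec j (m<n⇒m<1+n j<m)) k k<m′
...   | inj₂ refl       = trans fm (sym (≥⇒<ᵇ≡false (countBelow-≤ f m)))

final-countBelow : ∀ f m → (∀ k → suc k < m → f k ≡ true → f (suc k) ≡ true) →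
                   ∀ k → k < m → f k ≡ (m ∸ suc k <ᵇ countBelow f m)
final-countBelow f (suc m) inc k (s≤s k≤m) with f m in fm
... | true with m≤n⇒m<n∨m≡n k≤m
...   | inj₂ refl rewrite fm | n∸n≡0 k | +-comm (countBelow f k) 1 = refl
...   | inj₁ k<m rewrite +-comm (countBelow f m) 1 | ∸-suc k<m =
  final-countBelow f m (λ j j<m → inc j (m<n⇒m<1+n j<m)) k k<m
final-countBelow f (suc m) inc k (s≤s k≤m) | false
  rewrite +-identityʳ (countBelow f m) =
  trans (none-true k k≤m) (sym (≥⇒<ᵇ≡false (≤-trans (≤-reflexive count) z≤n)))
  where
  none-true : ∀ k → k ≤ m → f k ≡ false
  none-true k k≤m = up (m ∸ k) k (m∸n+n≡m k≤m)
    where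
    up : ∀ j k → j + k ≡ m → f k ≡ false
    up zero    k refl = fm
    up (suc j) k eq with f k in fk
    ... | false = refl
    ... | true  = trans (sym (inc k (s≤s (subst (suc k ≤_) eq (s≤s (m≤n+m k j)))) fk))
                        (up j (suc k) (trans (+-suc j k) eq))
  count : countBelow f m ≡ 0
  count = countBelow-initial m 0 z≤n (λ k k<m → trans (none-true k (<⇒≤ k<m)) (sym (≥⇒<ᵇ≡false {k} z≤n)))

preFin-inject₁ : ∀ {m} (s : Fin (suc m) → ℕ) k → preFin s (inject₁ k) + s (inject₁ k) ≡ preFin s (suc k)
preFin-inject₁ {suc m} s zero    = sym (+-identityʳ (s zero))
preFin-inject₁ {suc m} s (suc k) =
  trans (+-assoc (s zero) _ _) (cong (s zero +_) (preFin-inject₁ (λ i → s (suc i)) k))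

preFin-fromℕ : ∀ {m} (s : Fin (suc m) → ℕ) → preFin s (fromℕ m) + s (fromℕ m) ≡ sumFin s
preFin-fromℕ {zero}  s = sym (+-identityʳ (s zero))
preFin-fromℕ {suc m} s = trans (+-assoc (s zero) _ _) (cong (s zero +_) (preFin-fromℕ (λ i → s (suc i))))

preFin-≤ : ∀ {m} (s : Fin m → ℕ) i → preFin s i + s i ≤ sumFin s
preFin-≤ {suc m} s zero    = m≤m+n (s zero) _
preFin-≤ {suc m} s (suc i) =
  ≤-trans (≤-reflexive (+-assoc (s zero) _ _)) (+-monoʳ-≤ (s zero) (preFin-≤ (λ j → s (suc j)) i))

preFin-locate : ∀ {m} (s : Fin m → ℕ) q → q < sumFin s → ∃ λ i → ∃ λ k → k < s i × q ≡ preFin s i + k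
preFin-locate {suc m} s q q<Σ with q <? s zero
... | yes q<s = zero , q , q<s , refl
... | no  q≮s with preFin-locate (λ i → s (suc i)) (q ∸ s zero)
                     (+-cancelˡ-< (s zero) _ _ (subst (_< s zero + _) (sym (m+[n∸m]≡n (≮⇒≥ q≮s))) q<Σ))
...   | i , k , k<s , eq = suc i , k , k<s ,
  trans (sym (m+[n∸m]≡n (≮⇒≥ q≮s))) (trans (cong (s zero +_) eq) (sym (+-assoc (s zero) _ k)))

preFin-unique : ∀ {m} (s : Fin m → ℕ) i j {k l} → k < s i → l < s j →
                preFin s i + k ≡ preFin s j + l → i ≡ j × k ≡ l
preFin-unique s zero    zero    _   _   eq = refl , eq
preFin-unique s zero    (suc j) k<s _   eq =
  ⊥-elim (<⇒≱ k<s (≤-trans (m≤m+n (s zero) _) (≤-reflexive (sym (trans eq (+-assoc (s zero) _ _))))))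
preFin-unique s (suc i) zero    _   l<s eq =
  ⊥-elim (<⇒≱ l<s (≤-trans (m≤m+n (s zero) _) (≤-reflexive (trans (sym (+-assoc (s zero) _ _)) eq))))
preFin-unique s (suc i) (suc j) k<s l<s eq
  with preFin-unique (λ i → s (suc i)) i j k<s l<s
         (+-cancelˡ-≡ (s zero) _ _ (trans (sym (+-assoc (s zero) _ _)) (trans eq (+-assoc (s zero) _ _))))
... | refl , k≡l = refl , k≡l

countBelow-sumFin : ∀ {m} (s : Fin m → ℕ) f →
  countBelow f (sumFin s) ≡ sumFin (λ i → countBelow (λ k → f (preFin s i + k)) (s i))
countBelow-sumFin {zero}  s f = refl
countBelow-sumFin {suc m} s f = trans (countBelow-+ f (s zero) _) (cong (countBelow f (s zero) +_)
  (trans (countBelow-sumFin (λ i → s (suc i)) (λ j → f (s zero + j)))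
    (sumFin-cong λ i → countBelow-cong (s (suc i)) (λ k _ → cong f (sym (+-assoc (s zero) _ k))))))

lookupℕ-toℕ : ∀ {m} (v : Vec Bool m) x → lookupℕ v (toℕ x) ≡ lookup v x
lookupℕ-toℕ (b ∷ v) zero    = refl
lookupℕ-toℕ (b ∷ v) (suc x) = lookupℕ-toℕ v x

∣∣-countBelow : ∀ {m} (v : Subset m) → ∣ v ∣ ≡ countBelow (lookupℕ v) m
∣∣-countBelow [] = refl
∣∣-countBelow {suc m} (b ∷ v) = trans (head b) (sym (countBelow-+ (lookupℕ (b ∷ v)) 1 m))
  where
  head : ∀ b → ∣ b ∷ v ∣ ≡ indicator b + countBelow (lookupℕ v) m
  head true  = cong suc (∣∣-countBelow v)
  head false = ∣∣-countBelow v

-- The fence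

preFin-seam : ∀ {m} (s : Fin m → ℕ) j →
  preFin s (prevFin j) + s (prevFin j) ≡ preFin s j ⊎
  (preFin s j ≡ 0 × preFin s (prevFin j) + s (prevFin j) ≡ sumFin s)
preFin-seam {suc m} s zero    = inj₂ (refl , preFin-fromℕ s)
preFin-seam {suc m} s (suc j) = inj₁ (preFin-inject₁ s j)

∧-true : ∀ {b c} → b ∧ c ≡ true → b ≡ true × c ≡ true
∧-true {true} eq = refl , eq

∨-true : ∀ {b c} → b ∨ c ≡ true → b ≡ true ⊎ c ≡ true
∨-true {true}  _  = inj₁ refl
∨-true {false} eq = inj₂ eq

interval⁺ : ∀ {lo q hi} → lo ≤ q → q < hi → (lo ≤ᵇ q) ∧ (q <ᵇ hi) ≡ true
interval⁺ p q rewrite ≤⇒≤ᵇ≡true p = <⇒<ᵇ≡true q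

interval⁻ : ∀ lo q hi → (lo ≤ᵇ q) ∧ (q <ᵇ hi) ≡ true → lo ≤ q × q < hi
interval⁻ lo q hi eq with ∧-true {lo ≤ᵇ q} eq
... | p , r = ≤ᵇ≡true⇒≤ lo q p , <ᵇ≡true⇒< q hi r

-- The bound on `b` keeps the interval strictly above `p`, the minimum of the ascending segment,
-- which does not lie in Ã.
top-interval⁻ : ∀ p cap b q → b ≤ cap → p + suc cap ∸ b ≤ q → q < p + suc cap →
                ∃ λ k → k < cap × cap ∸ suc k < b × q ≡ p + suc k
top-interval⁻ p cap b q b≤f lo hi = k , k<f , +-cancelˡ-≤ k _ _ (begin
    k + suc (cap ∸ suc k)   ≡⟨ +-suc k _ ⟩
    suc k + (cap ∸ suc k)   ≡⟨ m+[n∸m]≡n k<f ⟩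
    cap                     ≤⟨ +-cancelˡ-≤ (suc p) _ _ (≤-trans above (≤-reflexive (trans (cong (_+ b) q≡) (+-assoc (suc p) k b)))) ⟩
    k + b                 ∎) , trans q≡ (sym (+-suc p k))
  where
  open ≤-Reasoning
  above : suc p + cap ≤ q + b
  above = ≤-trans (≤-reflexive (sym (+-suc p cap))) (≤-trans (m≤n+m∸n _ b) (≤-trans (+-monoʳ-≤ b lo) (≤-reflexive (+-comm b q))))
  p<q : suc p ≤ q
  p<q = +-cancelʳ-≤ cap _ _ (≤-trans above (+-monoʳ-≤ q b≤f))
  k = q ∸ suc p
  q≡ : q ≡ suc p + k
  q≡ = sym (m+[n∸m]≡n p<q)
  k<f : k < cap
  k<f = +-cancelˡ-< (suc p) _ _ (subst₂ _<_ q≡ (+-suc p cap) hi)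

top-interval⁺ : ∀ p cap b k → k < cap → cap ∸ suc k < b → p + suc cap ∸ b ≤ p + suc k
top-interval⁺ p cap b k k<f lt = m≤n+o⇒m∸n≤o (p + suc cap) b (begin
    p + suc cap                   ≡⟨ cong (λ g → p + suc g) (m+[n∸m]≡n k<f) ⟨
    p + suc (suc k + (cap ∸ suc k)) ≡⟨ shuffle p k (cap ∸ suc k) ⟩
    suc (cap ∸ suc k) + (p + suc k) ≤⟨ +-monoˡ-≤ (p + suc k) lt ⟩
    b + (p + suc k)             ∎)
  where
  open ≤-Reasoning
  shuffle : ∀ p k j → p + suc (suc k + j) ≡ suc j + (p + suc k)
  shuffle = solve-∀

module Geometry (ℓ : ℕ) (α δ : Fin ℓ → ℕ) (1≤α : ∀ i → 1 ≤ α i) (1≤δ : ∀ i → 1 ≤ δ i) where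
  open Fence ℓ α δ

  cap : Fin ℓ → ℕ
  cap i = α i ∸ 1

  α≡ : ∀ i → α i ≡ suc (cap i)
  α≡ i = sym (m+[n∸m]≡n (1≤α i))

  size : Fin ℓ → ℕ
  size i = α i + δ i

  t+ : ∀ i k → t i + k ≡ p i + (α i + k)
  t+ i k = +-assoc (p i) (α i) k

  end-≤n : ∀ i → p i + size i ≤ n
  end-≤n = preFin-≤ size

  <size⇒<n : ∀ i {k} → k < size i → p i + k < n
  <size⇒<n i k< = <-≤-trans (+-monoʳ-< (p i) k<) (end-≤n i)

  0<size : ∀ i → 0 < size i
  0<size i = ≤-trans (1≤α i) (m≤m+n (α i) (δ i))

  <f⇒<α : ∀ i {k} → k < cap i → suc k < α i
  <f⇒<α i k<f = subst (_ <_) (sym (α≡ i)) (s≤s k<f)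

  <f⇒<size : ∀ i {k} → k < cap i → suc k < size i
  <f⇒<size i k<f = <-≤-trans (<f⇒<α i k<f) (m≤m+n (α i) (δ i))

  p<n : ∀ i → p i < n
  p<n i = subst (_< n) (+-identityʳ (p i)) (<size⇒<n i (0<size i))

  elemAt-≐ : ∀ S {x r} → x ≐ r → elemAt S r ≡ lookup S x
  elemAt-≐ S {x} (inj₁ refl) rewrite <⇒<ᵇ≡true (toℕ<n x) = lookupℕ-toℕ S x
  elemAt-≐ S {x} (inj₂ refl) rewrite ≥⇒<ᵇ≡false (m≤n+m n (toℕ x)) | m+n∸n≡m (toℕ x) n = lookupℕ-toℕ S x

  elementAt : ∀ {r} → r < n → ∃ λ x → toℕ x ≡ r
  elementAt r<n = fromℕ< r<n , toℕ-fromℕ< r<n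

  ≐-inside : ∀ {x r} → r < n → x ≐ r → toℕ x ≡ r
  ≐-inside r<n (inj₁ eq) = eq
  ≐-inside {x} r<n (inj₂ eq) = ⊥-elim (<⇒≱ r<n (subst (n ≤_) eq (m≤n+m n (toℕ x))))

  -- The minimum of D `i` is also that of the next ascending segment. For the last `i` it sits at
  -- position `n` and at position 0, which `≐` identifies.
  seam : ∀ i → t i + δ i ≡ p (nextFin i) ⊎ (p (nextFin i) ≡ 0 × t i + δ i ≡ n)
  seam i rewrite t+ i (δ i) =
    subst (λ j → p j + size j ≡ p (nextFin i) ⊎ (p (nextFin i) ≡ 0 × p j + size j ≡ n))
      (prev-next i) (preFin-seam size (nextFin i))

  seam⁻ : ∀ i {x} → x ≐ (t i + δ i) → toℕ x ≡ p (nextFin i)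
  seam⁻ i {x} x≐ with seam i
  ... | inj₁ eq = ≐-inside (p<n (nextFin i)) (subst (x ≐_) eq x≐)
  ... | inj₂ (p≡0 , eq) rewrite eq with x≐
  ...   | inj₁ x≡n = ⊥-elim (<-irrefl x≡n (toℕ<n x))
  ...   | inj₂ x+n = trans (+-cancelʳ-≡ n (toℕ x) 0 x+n) (sym p≡0)

  seam⁺ : ∀ i {x} → toℕ x ≡ p (nextFin i) → x ≐ (t i + δ i)
  seam⁺ i x≡ with seam i
  ... | inj₁ eq         = inj₁ (trans x≡ (sym eq))
  ... | inj₂ (p≡0 , eq) = inj₂ (trans (cong (_+ n) (trans x≡ p≡0)) (sym eq))

  elementA : ∀ i {k} → k ≤ α i → ∃ λ x → x ≐ (p i + k)
  elementA i k≤α with elementAt (<size⇒<n i (≤-<-trans k≤α (m<m+n (α i) (1≤δ i))))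
  ... | x , eq = x , inj₁ eq

  elementD : ∀ i {k} → k ≤ δ i → ∃ λ x → x ≐ (t i + k)
  elementD i {k} k≤δ with m≤n⇒m<n∨m≡n k≤δ
  ... | inj₁ k<δ with elementAt (subst (_< n) (sym (t+ i k)) (<size⇒<n i (+-monoʳ-< (α i) k<δ)))
  ...   | x , eq = x , inj₁ eq
  elementD i k≤δ | inj₂ refl with elementAt (p<n (nextFin i))
  ...   | x , eq = x , seam⁺ i eq

  elemAt-seam : ∀ S i → elemAt S (t i + δ i) ≡ elemAt S (p (nextFin i))
  elemAt-seam S i with elementAt (p<n (nextFin i))
  ... | x , eq = trans (elemAt-≐ S (seam⁺ i eq)) (sym (elemAt-≐ S (inj₁ eq)))

  elemAt-bottom : ∀ S i → elemAt S (p i + 0) ≡ elemAt S (t (prevFin i) + δ (prevFin i))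
  elemAt-bottom S i = sym (trans (elemAt-seam S (prevFin i))
    (cong (elemAt S) (trans (cong p (next-prev i)) (sym (+-identityʳ (p i))))))

  elemAt-top : ∀ S i → elemAt S (p i + α i) ≡ elemAt S (t i + 0)
  elemAt-top S i = cong (elemAt S) (sym (+-identityʳ (t i)))

  -- Ideals and filters as closed predicates on positions, and their codes

  record Down (S : Subset n) : Set where
    field
      asc-closed  : ∀ i {k} → k < α i → elemAt S (p i + suc k) ≡ true → elemAt S (p i + k) ≡ true
      desc-closed : ∀ i {k} → k < δ i → elemAt S (t i + k) ≡ true → elemAt S (t i + suc k) ≡ true

  record Up (S : Subset n) : Set where
    field
      asc-closed  : ∀ i {k} → k < α i → elemAt S (p i + k) ≡ true → elemAt S (p i + suc k) ≡ true
      desc-closed : ∀ i {k} → k < δ i → elemAt S (t i + suc k) ≡ true → elemAt S (t i + k) ≡ true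

  transfer : ∀ {S x y r s} → x ≐ r → y ≐ s → (x ∈ S → y ∈ S) → elemAt S r ≡ true → elemAt S s ≡ true
  transfer {S} {x} x≐ y≐ to eq =
    trans (elemAt-≐ S y≐) ([]=⇒lookup (to (lookup⇒[]= x S (trans (sym (elemAt-≐ S x≐)) eq))))

  transfer⁻ : ∀ {S x y r s} → x ≐ r → y ≐ s → (elemAt S r ≡ true → elemAt S s ≡ true) → x ∈ S → y ∈ S
  transfer⁻ {S} {x} {y} x≐ y≐ to x∈ =
    lookup⇒[]= y S (trans (sym (elemAt-≐ S y≐)) (to (trans (elemAt-≐ S x≐) ([]=⇒lookup x∈))))

  ideal⇒down : ∀ {S} → IsIdeal S → Down S
  ideal⇒down ideal = record
    { asc-closed  = λ i {k} k<α → let (x , x≐) = elementA i (<⇒≤ k<α) ; (y , y≐) = elementA i k<α in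
        transfer y≐ x≐ (ideal (asc i k k<α x≐ y≐ ◅ ε))
    ; desc-closed = λ i {k} k<δ → let (y , y≐) = elementD i (<⇒≤ k<δ) ; (x , x≐) = elementD i k<δ in
        transfer y≐ x≐ (ideal (desc i k k<δ y≐ x≐ ◅ ε))
    }

  filter⇒up : ∀ {S} → IsFilter S → Up S
  filter⇒up filt = record
    { asc-closed  = λ i {k} k<α → let (x , x≐) = elementA i (<⇒≤ k<α) ; (y , y≐) = elementA i k<α in
        transfer x≐ y≐ (filt (asc i k k<α x≐ y≐ ◅ ε))
    ; desc-closed = λ i {k} k<δ → let (y , y≐) = elementD i (<⇒≤ k<δ) ; (x , x≐) = elementD i k<δ in
        transfer x≐ y≐ (filt (desc i k k<δ y≐ x≐ ◅ ε))
    }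

  down⇒ideal : ∀ {S} → Down S → IsIdeal S
  down⇒ideal {S} down = closed
    where
    open Down down
    covers : ∀ {x y} → x ⋖ y → y ∈ S → x ∈ S
    covers (asc i k k<α x≐ y≐)  = transfer⁻ y≐ x≐ (asc-closed i k<α)
    covers (desc i k k<δ y≐ x≐) = transfer⁻ y≐ x≐ (desc-closed i k<δ)
    closed : IsIdeal S
    closed ε        x∈ = x∈
    closed (c ◅ cs) x∈ = covers c (closed cs x∈)

  up⇒filter : ∀ {S} → Up S → IsFilter S
  up⇒filter {S} up = closed
    where
    open Up up
    covers : ∀ {x y} → x ⋖ y → x ∈ S → y ∈ S
    covers (asc i k k<α x≐ y≐)  = transfer⁻ x≐ y≐ (asc-closed i k<α)
    covers (desc i k k<δ y≐ x≐) = transfer⁻ x≐ y≐ (desc-closed i k<δ)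
    closed : IsFilter S
    closed ε        x∈ = x∈
    closed (c ◅ cs) x∈ = closed cs (covers c x∈)

  -- Positions climb along an ascending segment and descend along D, so the elements of an ideal
  -- come first in Ã and last in D; for a filter it is the other way round.
  record IdealShape (S : Subset n) (a d : Fin ℓ → ℕ) : Set where
    field
      onA : ∀ i {k} → k < cap i → elemAt S (p i + suc k) ≡ (k <ᵇ a i)
      onD : ∀ i {k} → k ≤ δ i → elemAt S (t i + k) ≡ (δ i ∸ k <ᵇ d i)

  record FilterShape (S : Subset n) (b e : Fin ℓ → ℕ) : Set where
    field
      onA : ∀ i {k} → k < cap i → elemAt S (p i + suc k) ≡ (cap i ∸ suc k <ᵇ b i)
      onD : ∀ i {k} → k ≤ δ i → elemAt S (t i + k) ≡ (k <ᵇ e i)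

  -- The Ã and the D cover the fence: the one position of a block outside its own Ã and D, at offset
  -- 0, is the minimum of the preceding D.
  subset-ext : ∀ {S S′} →
    (∀ i {k} → k < cap i → elemAt S (p i + suc k) ≡ elemAt S′ (p i + suc k)) →
    (∀ i {k} → k ≤ δ i → elemAt S (t i + k) ≡ elemAt S′ (t i + k)) → S ≡ S′
  subset-ext {S} {S′} onA onD =
    trans (sym (tabulate∘lookup S)) (trans (tabulate-cong same-lookup) (tabulate∘lookup S′))
    where
    at : ∀ i k → k < size i → elemAt S (p i + k) ≡ elemAt S′ (p i + k)
    at i zero    _   = trans (elemAt-bottom S i) (trans (onD (prevFin i) ≤-refl) (sym (elemAt-bottom S′ i)))
    at i (suc k) k<s with k <? cap i
    ... | yes k<f = onA i k<f
    ... | no  k≮f = subst (λ r → elemAt S r ≡ elemAt S′ r) eq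
                      (onD i (<⇒≤ (+-cancelˡ-< (α i) _ _ (subst (_< size i) (sym (m+[n∸m]≡n α≤k)) k<s))))
      where
      α≤k : α i ≤ suc k
      α≤k = subst (_≤ suc k) (sym (α≡ i)) (s≤s (≮⇒≥ k≮f))
      eq : t i + (suc k ∸ α i) ≡ p i + suc k
      eq = trans (t+ i _) (cong (p i +_) (m+[n∸m]≡n α≤k))

    same-lookup : ∀ x → lookup S x ≡ lookup S′ x
    same-lookup x with preFin-locate size (toℕ x) (toℕ<n x)
    ... | i , k , k<s , eq =
      trans (sym (elemAt-≐ S (inj₁ eq))) (trans (at i k k<s) (elemAt-≐ S′ (inj₁ eq)))

  encA-≤ : ∀ S i → encA S i ≤ cap i
  encA-≤ S i = countBelow-≤ _ (cap i)

  encD-≤ : ∀ S i → encD S i ≤ suc (δ i)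
  encD-≤ S i = countBelow-≤ _ (suc (δ i))

  down-shape : ∀ {S} → Down S → IdealShape S (encA S) (encD S)
  down-shape {S} down = record
    { onA = λ i {k} → initial-countBelow (λ k → elemAt S (p i + suc k)) (cap i)
                        (λ k k<f → asc-closed i (<⇒≤ (<f⇒<α i k<f))) k
    ; onD = λ i {k} k≤δ → final-countBelow (λ k → elemAt S (t i + k)) (suc (δ i))
                        (λ { k (s≤s k<δ) → desc-closed i k<δ }) k (s≤s k≤δ)
    }
    where open Down down

  up-shape : ∀ {S} → Up S → FilterShape S (encA S) (encD S)
  up-shape {S} up = record
    { onA = λ i {k} → final-countBelow (λ k → elemAt S (p i + suc k)) (cap i)
                        (λ k k<f → asc-closed i (<f⇒<α i (<⇒≤ k<f))) k
    ; onD = λ i {k} k≤δ → initial-countBelow (λ k → elemAt S (t i + k)) (suc (δ i))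
                        (λ { k (s≤s k<δ) → desc-closed i k<δ }) k (s≤s k≤δ)
    }
    where open Up up

  not-both : ∀ {b : Bool} → b ≡ true → b ≡ false → ⊥
  not-both refl ()

  ≢-full : ∀ {m k} → k ≤ m → (k < m → ⊥) → k ≡ m
  ≢-full k≤m k≮m = ≤-antisym k≤m (≮⇒≥ k≮m)

  -- If all of D `i` is present then so is its maximum, and descending the ascending segment below
  -- it yields all of Ã `i` and the minimum.
  down-code : ∀ {S} → Down S → IdealCode cap δ (encA S) (encD S)
  down-code {S} down = record { bound = encA-≤ S ; support = support ; top = top }
    where
    open Down down
    open IdealShape (down-shape down)

    bottom⇒1≤d : ∀ i → elemAt S (p i + 0) ≡ true → 1 ≤ encD S (prevFin i)
    bottom⇒1≤d i eq = <ᵇ≡true⇒< 0 _ (trans (cong (_<ᵇ encD S j) (sym (n∸n≡0 (δ j))))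
                        (trans (sym (onD j ≤-refl)) (trans (sym (elemAt-bottom S i)) eq)))
      where j = prevFin i

    support : ∀ i → 1 ≤ encA S i → 1 ≤ encD S (prevFin i)
    support i 1≤a = bottom⇒1≤d i (asc-closed i (1≤α i)
      (trans (onA i (≤-trans 1≤a (encA-≤ S i))) (<⇒<ᵇ≡true 1≤a)))

    top : Top prevFin cap δ (encA S) (encD S)
    top i with m≤n⇒m<n∨m≡n (encD-≤ S i)
    ... | inj₁ (s≤s d≤δ) = inj₁ d≤δ
    ... | inj₂ d≡ = inj₂ (d≡ , a≡f , bottom⇒1≤d i (below (α i) 0 (+-identityʳ (α i))))
      where
      below : ∀ j k → j + k ≡ α i → elemAt S (p i + k) ≡ true
      below zero    k refl = trans (elemAt-top S i)
        (trans (onD i z≤n) (<⇒<ᵇ≡true (subst (δ i <_) (sym d≡) ≤-refl)))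
      below (suc j) k eq   = asc-closed i (subst (suc k ≤_) eq (s≤s (m≤n+m k j)))
        (below j (suc k) (trans (+-suc j k) eq))

      a≡f : encA S i ≡ cap i
      -- Otherwise the lowest element of Ã `i` missing from `S` would be present.
      a≡f = ≢-full (encA-≤ S i) λ a<f → not-both
        (below (α i ∸ suc (encA S i)) (suc (encA S i)) (m∸n+n≡m (<⇒≤ (<f⇒<α i a<f))))
        (trans (onA i a<f) (≥⇒<ᵇ≡false (≤-refl {encA S i})))

  up-code : ∀ {S} → Up S → FilterCode cap δ (encA S) (encD S)
  up-code {S} up = record { bound = encA-≤ S ; support = support ; top = top }
    where
    open Up up
    open FilterShape (up-shape up)

    top⇒1≤e : ∀ i → elemAt S (p i + α i) ≡ true → 1 ≤ encD S i
    top⇒1≤e i eq = <ᵇ≡true⇒< 0 _ (trans (sym (onD i z≤n)) (trans (sym (elemAt-top S i)) eq))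

    support : ∀ i → 1 ≤ encA S i → 1 ≤ encD S i
    support i 1≤b = top⇒1≤e i (subst (λ k → elemAt S (p i + k) ≡ true) (sym α≡₂)
      (asc-closed i (≤-reflexive (sym α≡₂)) (trans (onA i (≤-reflexive (sym f≡)))
        (trans (cong (_<ᵇ encA S i) (trans (cong (cap i ∸_) (sym f≡)) (n∸n≡0 (cap i)))) (<⇒<ᵇ≡true 1≤b)))))
      where
      f≡ : cap i ≡ suc (cap i ∸ 1)
      f≡ = sym (m+[n∸m]≡n (≤-trans 1≤b (encA-≤ S i)))
      α≡₂ : α i ≡ suc (suc (cap i ∸ 1))
      α≡₂ = trans (α≡ i) (cong suc f≡)

    top : Top nextFin (cap ∘ nextFin) δ (encA S ∘ nextFin) (encD S)
    top j with m≤n⇒m<n∨m≡n (encD-≤ S j)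
    ... | inj₁ (s≤s e≤δ) = inj₁ e≤δ
    ... | inj₂ e≡ = inj₂ (e≡ , b≡f , top⇒1≤e i (above (α i) ≤-refl))
      where
      i = nextFin j

      above : ∀ k → k ≤ α i → elemAt S (p i + k) ≡ true
      above zero    _   = trans (cong (elemAt S) (+-identityʳ (p i))) (trans (sym (elemAt-seam S j))
        (trans (onD j ≤-refl) (<⇒<ᵇ≡true (subst (δ j <_) (sym e≡) ≤-refl))))
      above (suc k) k<α = asc-closed i k<α (above k (<⇒≤ k<α))

      b≡f : encA S i ≡ cap i
      -- The contradiction occurs at the element with exactly `encA S i` elements of Ã `i` above it,
      -- the highest one outside `S`.
      b≡f = ≢-full (encA-≤ S i) λ b<f → not-both
        (above (suc (cap i ∸ suc (encA S i))) (<⇒≤ (<f⇒<α i (m∸1+n<m b<f))))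
        (trans (onA i (m∸1+n<m b<f)) (trans (cong (_<ᵇ encA S i) (flip b<f)) (≥⇒<ᵇ≡false (≤-refl {encA S i}))))
        where
        m∸1+n<m : ∀ {m n} → n < m → m ∸ suc n < m
        m∸1+n<m {suc m} {n} _ = s≤s (m∸n≤m m n)
        flip : ∀ {m n} → n < m → m ∸ suc (m ∸ suc n) ≡ n
        flip {suc m} {n} (s≤s n≤m) = m∸[m∸n]≡n n≤m

  -- Inside Ã and inside D the shape suffices. Closure at the lowest cover of an ascending segment
  -- comes from `support`, at the highest one from `top`.
  code-down : ∀ {S a d} → IdealCode cap δ a d → IdealShape S a d → Down S
  code-down {S} {a} {d} code shape = record { asc-closed = ascending ; desc-closed = descending }
    where
    open IdealCode code
    open IdealShape shape

    bottom : ∀ i → 1 ≤ d (prevFin i) → elemAt S (p i + 0) ≡ true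
    bottom i 1≤d = trans (elemAt-bottom S i) (trans (onD j ≤-refl)
                     (trans (cong (_<ᵇ d j) (n∸n≡0 (δ j))) (<⇒<ᵇ≡true 1≤d)))
      where j = prevFin i

    ascending : ∀ i {k} → k < α i → elemAt S (p i + suc k) ≡ true → elemAt S (p i + k) ≡ true
    ascending i {k} k<α eq with k <? cap i
    ascending i {zero}  k<α eq | yes k<f = bottom i (support i (<ᵇ≡true⇒< 0 (a i) (trans (sym (onA i k<f)) eq)))
    ascending i {suc k} k<α eq | yes k<f =
      trans (onA i (<⇒≤ k<f)) (<ᵇ-mono (n≤1+n k) (≤-refl {a i}) (trans (sym (onA i k<f)) eq))
    ascending i {k} k<α eq | no k≮f with top i
    ... | inj₁ d≤δ = ⊥-elim (not-both at-top (trans (onD i z≤n) (≥⇒<ᵇ≡false d≤δ)))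
      where
      at-top : elemAt S (t i + 0) ≡ true
      at-top = trans (sym (elemAt-top S i)) (subst (λ k → elemAt S (p i + k) ≡ true)
                 (≤-antisym k<α (subst (_≤ suc k) (sym (α≡ i)) (s≤s (≮⇒≥ k≮f)))) eq)
    -- Here Ã `i` is empty, and a single cover joins the two neighbouring D.
    ascending i {zero}  k<α eq | no k≮f | inj₂ (_ , a≡f , 1≤d) = bottom i 1≤d
    ascending i {suc k} k<α eq | no k≮f | inj₂ (_ , a≡f , 1≤d) =
      trans (onA i k<f) (<⇒<ᵇ≡true (subst (k <_) (sym a≡f) k<f))
      where
      k<f : k < cap i
      k<f = ≤-pred (subst (suc k <_) (α≡ i) k<α)

    descending : ∀ i {k} → k < δ i → elemAt S (t i + k) ≡ true → elemAt S (t i + suc k) ≡ true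
    descending i {k} k<δ eq = trans (onD i k<δ)
      (<ᵇ-mono (∸-monoʳ-≤ (δ i) (n≤1+n k)) (≤-refl {d i}) (trans (sym (onD i (<⇒≤ k<δ))) eq))

  code-up : ∀ {S b e} → FilterCode cap δ b e → FilterShape S b e → Up S
  code-up {S} {b} {e} code shape = record { asc-closed = ascending ; desc-closed = descending }
    where
    open FilterCode code
    open FilterShape shape

    at-top : ∀ i {k} → k < α i → (k < cap i → ⊥) → 1 ≤ e i → elemAt S (p i + suc k) ≡ true
    at-top i {k} k<α k≮f 1≤e = subst (λ k → elemAt S (p i + k) ≡ true)
      (≤-antisym (subst (_≤ suc k) (sym (α≡ i)) (s≤s (≮⇒≥ k≮f))) k<α)
      (trans (elemAt-top S i) (trans (onD i z≤n) (<⇒<ᵇ≡true 1≤e)))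

    ascending : ∀ i {k} → k < α i → elemAt S (p i + k) ≡ true → elemAt S (p i + suc k) ≡ true
    ascending i {zero} k<α eq with top (prevFin i)
    ... | inj₁ e≤δ = ⊥-elim (not-both eq (trans (elemAt-bottom S i)
                       (trans (onD (prevFin i) ≤-refl) (≥⇒<ᵇ≡false e≤δ))))
    ... | inj₂ (_ , b≡f , 1≤e) rewrite next-prev i with 0 <? cap i
    ...   | no  0≮f = at-top i k<α 0≮f 1≤e
    ...   | yes 0<f = trans (onA i 0<f) (<⇒<ᵇ≡true (subst (cap i ∸ 1 <_) (sym b≡f)
                        (≤-reflexive (m+[n∸m]≡n 0<f))))
    ascending i {suc k} k<α eq with suc k <? cap i
    ... | yes k<f = trans (onA i k<f)
          (<ᵇ-mono (∸-monoʳ-≤ (cap i) (n≤1+n (suc k))) (≤-refl {b i}) (trans (sym (onA i (<⇒≤ k<f))) eq))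
    ... | no  k≮f = at-top i k<α k≮f (support i (≤-<-trans z≤n
          (<ᵇ≡true⇒< _ (b i) (trans (sym (onA i (≤-pred (subst (suc k <_) (α≡ i) k<α)))) eq))))

    descending : ∀ i {k} → k < δ i → elemAt S (t i + suc k) ≡ true → elemAt S (t i + k) ≡ true
    descending i {k} k<δ eq = trans (onD i (<⇒≤ k<δ))
      (<ᵇ-mono (n≤1+n k) (≤-refl {e i}) (trans (sym (onD i k<δ)) eq))

  -- Recovering codes from shapes, cardinality, decoding

  idealShape-enc : ∀ {S a d} → (∀ i → a i ≤ cap i) → (∀ i → d i ≤ suc (δ i)) → IdealShape S a d →
                   (∀ i → encA S i ≡ a i) × (∀ i → encD S i ≡ d i)
  idealShape-enc a≤ d≤ shape =
    (λ i → countBelow-initial (cap i) _ (a≤ i) (λ k → onA i)) ,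
    (λ i → countBelow-final (suc (δ i)) _ (d≤ i) (λ { k (s≤s k≤δ) → onD i k≤δ }))
    where open IdealShape shape

  filterShape-enc : ∀ {S b e} → (∀ i → b i ≤ cap i) → (∀ i → e i ≤ suc (δ i)) → FilterShape S b e →
                    (∀ i → encA S i ≡ b i) × (∀ i → encD S i ≡ e i)
  filterShape-enc b≤ e≤ shape =
    (λ i → countBelow-final (cap i) _ (b≤ i) (λ k → onA i)) ,
    (λ i → countBelow-initial (suc (δ i)) _ (e≤ i) (λ { k (s≤s k≤δ) → onD i k≤δ }))
    where open FilterShape shape

  top-≤ : ∀ {pv : Fin ℓ → Fin ℓ} {g a d} → Top pv g δ a d → ∀ i → d i ≤ suc (δ i)
  top-≤ top i with top i
  ... | inj₁ d≤δ      = m≤n⇒m≤1+n d≤δ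
  ... | inj₂ (d≡ , _) = ≤-reflexive d≡

  -- The block of positions starting at `p i` contains the minimum of the preceding D and lacks that
  -- of its own D, while the code counts the latter. The correction `h` is only shifted by one index
  -- and cancels in the sum.
  card-enc : ∀ S → ∣ S ∣ ≡ sumFin (encA S) + sumFin (encD S)
  card-enc S = +-cancelʳ-≡ (sumFin h) _ _ (begin
    ∣ S ∣ + sumFin h                             ≡⟨ cong (_+ sumFin h) total ⟩
    sumFin seg + sumFin h                        ≡⟨ cong (sumFin seg +_) h-next ⟨
    sumFin seg + sumFin (h ∘ nextFin)            ≡⟨ sumFin-+ seg _ ⟨
    sumFin (λ i → seg i + h (nextFin i))         ≡⟨ sumFin-cong segment ⟩
    sumFin (λ i → encA S i + encD S i + h i)     ≡⟨ sumFin-+ (λ i → encA S i + encD S i) h ⟩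
    sumFin (λ i → encA S i + encD S i) + sumFin h ≡⟨ cong (_+ sumFin h) (sumFin-+ (encA S) (encD S)) ⟩
    sumFin (encA S) + sumFin (encD S) + sumFin h ∎)
    where
    open ≡-Reasoning

    h seg : Fin ℓ → ℕ
    h i   = indicator (elemAt S (p i))
    seg i = countBelow (λ k → elemAt S (p i + k)) (size i)

    h-next : sumFin (h ∘ nextFin) ≡ sumFin h
    h-next = trans (sym (sumFin-prev (h ∘ nextFin))) (sumFin-cong (λ i → cong h (next-prev i)))

    total : ∣ S ∣ ≡ sumFin seg
    total = trans (∣∣-countBelow S) (trans
      (countBelow-cong n (λ k k<n → sym (cong (λ b → if b then lookupℕ S k else lookupℕ S (k ∸ n)) (<⇒<ᵇ≡true k<n))))
      (countBelow-sumFin size (elemAt S)))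

    shuffle : ∀ x a d y → x + a + d + y ≡ a + (d + y) + x
    shuffle = solve-∀

    segment : ∀ i → seg i + h (nextFin i) ≡ encA S i + encD S i + h i
    segment i = begin
      seg i + h (nextFin i)
        ≡⟨ cong (_+ h (nextFin i)) (countBelow-+ at (α i) (δ i)) ⟩
      countBelow at (α i) + onD + h (nextFin i)
        ≡⟨ cong (λ m → countBelow at m + onD + h (nextFin i)) (α≡ i) ⟩
      countBelow at (1 + cap i) + onD + h (nextFin i)
        ≡⟨ cong (λ m → m + onD + h (nextFin i)) (countBelow-+ at 1 (cap i)) ⟩
      indicator (at 0) + encA S i + onD + h (nextFin i)
        ≡⟨ shuffle (indicator (at 0)) (encA S i) onD (h (nextFin i)) ⟩
      encA S i + (onD + h (nextFin i)) + indicator (at 0)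
        ≡⟨ cong₂ (λ x y → encA S i + x + y)
             (cong₂ _+_ (countBelow-cong (δ i) (λ k _ → cong (elemAt S) (sym (t+ i k))))
                        (cong indicator (sym (elemAt-seam S i))))
             (cong (indicator ∘ elemAt S) (+-identityʳ (p i))) ⟩
      encA S i + encD S i + h i ∎
      where
      at : ℕ → Bool
      at k = elemAt S (p i + k)
      onD : ℕ
      onD = countBelow (λ k → at (α i + k)) (δ i)

  -- Offset 0 of block `i` is the minimum of the preceding D, present as soon as that D contributes
  -- anything. Working by block and offset avoids overlapping intervals.
  idealMember : (a d : Fin ℓ → ℕ) → Fin ℓ → ℕ → Bool
  idealMember a d i zero    = 0 <ᵇ d (prevFin i)
  idealMember a d i (suc k) = if k <ᵇ cap i then k <ᵇ a i else (δ i ∸ (suc k ∸ α i) <ᵇ d i)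

  decodeIdeal : (Fin ℓ → ℕ) → (Fin ℓ → ℕ) → Subset n
  decodeIdeal a d = Vec.tabulate λ x →
    let (i , k , _) = preFin-locate size (toℕ x) (toℕ<n x) in idealMember a d i k

  decodeIdeal-shape : ∀ a d → IdealShape (decodeIdeal a d) a d
  decodeIdeal-shape a d = record { onA = onA ; onD = onD }
    where
    S = decodeIdeal a d

    at : ∀ i k → k < size i → elemAt S (p i + k) ≡ idealMember a d i k
    at i k k<s with elementAt (<size⇒<n i k<s)
    ... | x , x≡ = trans (elemAt-≐ S (inj₁ x≡)) (trans (lookup∘tabulate _ x)
                     (located (preFin-locate size (toℕ x) (toℕ<n x))))
      where
      -- Quantifying over all locations frees the argument from the one that `preFin-locate`
      -- returns; uniqueness identifies it with `(i , k)`.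
      located : (loc : ∃ λ j → ∃ λ l → l < size j × toℕ x ≡ p j + l) →
                let (j , l , _) = loc in idealMember a d j l ≡ idealMember a d i k
      located (j , l , l<s , eq) with preFin-unique size j i l<s k<s (trans (sym eq) x≡)
      ... | refl , refl = refl

    onA : ∀ i {k} → k < cap i → elemAt S (p i + suc k) ≡ (k <ᵇ a i)
    onA i {k} k<f rewrite at i (suc k) (<f⇒<size i k<f) | <⇒<ᵇ≡true k<f = refl

    onD : ∀ i {k} → k ≤ δ i → elemAt S (t i + k) ≡ (δ i ∸ k <ᵇ d i)
    onD i {k} k≤δ with m≤n⇒m<n∨m≡n k≤δ
    ... | inj₂ refl = trans (elemAt-seam S i) (trans (cong (elemAt S) (sym (+-identityʳ (p (nextFin i)))))
            (trans (at (nextFin i) 0 (0<size (nextFin i)))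
              (cong₂ (λ x j → x <ᵇ d j) (sym (n∸n≡0 (δ i))) (prev-next i))))
    ... | inj₁ k<δ = trans (cong (elemAt S) (t+ i k)) (trans (at i (α i + k) (+-monoʳ-< (α i) k<δ)) member)
      where
      member : idealMember a d i (α i + k) ≡ (δ i ∸ k <ᵇ d i)
      member = trans (cong (λ m → idealMember a d i (m + k)) (α≡ i))
        (trans (cong (λ b → if b then (cap i + k) <ᵇ a i else (δ i ∸ (suc (cap i) + k ∸ α i) <ᵇ d i))
                 (≥⇒<ᵇ≡false (m≤m+n (cap i) k)))
          (cong (λ m → δ i ∸ m <ᵇ d i)
            (trans (cong (λ m → m + k ∸ α i) (sym (α≡ i))) (m+n∸m≡n (α i) k))))

  -- The partition into Ã and D, and the decoding of filters

  coordA : ∀ i {k x} → k < cap i → x ≐ (p i + suc k) → toℕ x ≡ p i + suc k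
  coordA i k<f = ≐-inside (<size⇒<n i (<f⇒<size i k<f))

  coordD : ∀ i {k x} → k ≤ δ i → x ≐ (t i + k) →
           (k < δ i × toℕ x ≡ p i + (α i + k)) ⊎ (k ≡ δ i × toℕ x ≡ p (nextFin i) + 0)
  coordD i {k} {x} k≤δ x≐ with m≤n⇒m<n∨m≡n k≤δ
  ... | inj₁ k<δ  = inj₁ (k<δ , ≐-inside (<size⇒<n i (+-monoʳ-< (α i) k<δ)) (subst (x ≐_) (t+ i k) x≐))
  ... | inj₂ refl = inj₂ (refl , trans (seam⁻ i x≐) (sym (+-identityʳ _)))

  uniqueA : ∀ i j {k l x} → k < cap i → l < cap j → x ≐ (p i + suc k) → x ≐ (p j + suc l) → i ≡ j × k ≡ l
  uniqueA i j k< l< x≐ x≐′ with preFin-unique size i j (<f⇒<size i k<) (<f⇒<size j l<)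
                                  (trans (sym (coordA i k< x≐)) (coordA j l< x≐′))
  ... | i≡j , eq = i≡j , suc-injective eq

  A-D-disjoint : ∀ i j {k l x} → k < cap i → l ≤ δ j → x ≐ (p i + suc k) → x ≐ (t j + l) → ⊥
  A-D-disjoint i j k< l≤ x≐ x≐′ with coordD j l≤ x≐′
  ... | inj₁ (l< , eq) with preFin-unique size i j (<f⇒<size i k<) (+-monoʳ-< (α j) l<)
                              (trans (sym (coordA i k< x≐)) eq)
  ...   | refl , k≡ = <⇒≱ (<f⇒<α i k<) (subst (α i ≤_) (sym k≡) (m≤m+n (α i) _))
  A-D-disjoint i j k< l≤ x≐ x≐′ | inj₂ (_ , eq)
    with preFin-unique size i (nextFin j) (<f⇒<size i k<) (0<size (nextFin j))
           (trans (sym (coordA i k< x≐)) eq)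
  ...   | _ , ()

  uniqueD : ∀ i j {k l x} → k ≤ δ i → l ≤ δ j → x ≐ (t i + k) → x ≐ (t j + l) → i ≡ j × k ≡ l
  uniqueD i j k≤ l≤ x≐ x≐′ with coordD i k≤ x≐ | coordD j l≤ x≐′
  ... | inj₁ (k< , eq) | inj₁ (l< , eq′)
    with preFin-unique size i j (+-monoʳ-< (α i) k<) (+-monoʳ-< (α j) l<) (trans (sym eq) eq′)
  ...   | refl , k≡l = refl , +-cancelˡ-≡ (α i) _ _ k≡l
  uniqueD i j k≤ l≤ x≐ x≐′ | inj₁ (k< , eq) | inj₂ (_ , eq′)
    with preFin-unique size i (nextFin j) (+-monoʳ-< (α i) k<) (0<size (nextFin j)) (trans (sym eq) eq′)
  ...   | _ , α≡0 = ⊥-elim (<⇒≢ (≤-trans (1≤α i) (m≤m+n (α i) _)) (sym α≡0))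
  uniqueD i j k≤ l≤ x≐ x≐′ | inj₂ (_ , eq) | inj₁ (l< , eq′)
    with preFin-unique size j (nextFin i) (+-monoʳ-< (α j) l<) (0<size (nextFin i)) (trans (sym eq′) eq)
  ...   | _ , α≡0 = ⊥-elim (<⇒≢ (≤-trans (1≤α j) (m≤m+n (α j) _)) (sym α≡0))
  uniqueD i j k≤ l≤ x≐ x≐′ | inj₂ (k≡δ , eq) | inj₂ (l≡δ , eq′)
    with preFin-unique size (nextFin i) (nextFin j) (0<size (nextFin i)) (0<size (nextFin j)) (trans (sym eq) eq′)
  ...   | next≡ , _ with trans (sym (prev-next i)) (trans (cong prevFin next≡) (prev-next j))
  ...     | refl = refl , trans k≡δ (sym l≡δ)

  module _ {b e : Fin ℓ → ℕ} (b≤ : ∀ i → b i ≤ cap i) (e≤ : ∀ i → e i ≤ suc (δ i)) where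

    private
      S = decodeFilter b e

      -- Says which interval of `decodeFilter` contains `x`; `≐` absorbs the separate interval for
      -- the wrapped position.
      data Member (x : Fin n) (i : Fin ℓ) : Set where
        inA : ∀ k → k < cap i → cap i ∸ suc k < b i → x ≐ (p i + suc k) → Member x i
        inD : ∀ k → k < e i → x ≐ (t i + k) → Member x i

      t≡ : ∀ i → t i ≡ p i + suc (cap i)
      t≡ i = cong (p i +_) (α≡ i)

      offset : ∀ {m q h} → m ≤ q → q < m + h → ∃ λ k → k < h × q ≡ m + k
      offset {m} {q} {h} m≤q q<m+h = q ∸ m , +-cancelˡ-< m _ _ (subst (_< m + h) (sym (m+[n∸m]≡n m≤q)) q<m+h) ,
                                 sym (m+[n∸m]≡n m≤q)

      member⁻ : ∀ x → lookup S x ≡ true → ∃ (Member x)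
      member⁻ x eq with anyFin⁻ _ (trans (sym (lookup∘tabulate _ x)) eq)
      ... | i , hit with ∨-true {(t i ∸ b i ≤ᵇ toℕ x) ∧ (toℕ x <ᵇ t i)} hit
      ... | inj₁ h₁ with interval⁻ (t i ∸ b i) (toℕ x) (t i) h₁
      ...   | lo , hi with top-interval⁻ (p i) (cap i) (b i) (toℕ x) (b≤ i)
                             (subst (λ r → r ∸ b i ≤ toℕ x) (t≡ i) lo) (subst (toℕ x <_) (t≡ i) hi)
      ...     | k , k<f , lt , x≡ = i , inA k k<f lt (inj₁ x≡)
      member⁻ x eq | i , hit | inj₂ h with ∨-true {(t i ≤ᵇ toℕ x) ∧ (toℕ x <ᵇ t i + e i)} h
      ... | inj₁ h₂ with interval⁻ (t i) (toℕ x) (t i + e i) h₂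
      ...   | lo , hi with offset lo hi
      ...     | k , k<e , x≡ = i , inD k k<e (inj₁ x≡)
      member⁻ x eq | i , hit | inj₂ h | inj₂ h₃ with interval⁻ (t i) (toℕ x + n) (t i + e i) h₃
      ...   | lo , hi with offset lo hi
      ...     | k , k<e , x≡ = i , inD k k<e (inj₂ x≡)

      member⁺ : ∀ x i → Member x i → lookup S x ≡ true
      member⁺ x i mem = trans (lookup∘tabulate _ x) (anyFin⁺ _ i (hit mem))
        where
        hit : Member x i → ((t i ∸ b i ≤ᵇ toℕ x) ∧ (toℕ x <ᵇ t i))
                         ∨ ((t i ≤ᵇ toℕ x) ∧ (toℕ x <ᵇ t i + e i))
                         ∨ ((t i ≤ᵇ toℕ x + n) ∧ (toℕ x + n <ᵇ t i + e i)) ≡ true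
        hit (inA k k<f lt x≐) rewrite coordA i k<f x≐
          | interval⁺ (subst (λ r → r ∸ b i ≤ p i + suc k) (sym (t≡ i)) (top-interval⁺ (p i) (cap i) (b i) k k<f lt))
                      (+-monoʳ-< (p i) (<f⇒<α i k<f)) = refl
        hit (inD k k<e (inj₁ eq)) rewrite eq | interval⁺ (m≤m+n (t i) k) (+-monoʳ-< (t i) k<e) = ∨-zeroʳ _
        hit (inD k k<e (inj₂ eq)) rewrite eq | interval⁺ (m≤m+n (t i) k) (+-monoʳ-< (t i) k<e)
          | ∨-zeroʳ ((t i ≤ᵇ toℕ x) ∧ (toℕ x <ᵇ t i + e i)) = ∨-zeroʳ _

    -- `decodeFilter` is a union over all indices, so an element might be contributed by a foreign
    -- interval. The bounds keep each interval inside its own Ã or D, and these are disjoint.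
    decodeFilter-shape : FilterShape S b e
    decodeFilter-shape = record { onA = onA ; onD = onD }
      where
      e⇒δ : ∀ i {k} → k < e i → k ≤ δ i
      e⇒δ i k<e = ≤-pred (≤-trans k<e (e≤ i))

      onA : ∀ i {k} → k < cap i → elemAt S (p i + suc k) ≡ (cap i ∸ suc k <ᵇ b i)
      onA i {k} k<f with elementA i (<⇒≤ (<f⇒<α i k<f))
      ... | x , x≐ = trans (elemAt-≐ S x≐) (Bool-ext
              (λ eq → to (member⁻ x eq))
              (λ eq → member⁺ x i (inA k k<f (<ᵇ≡true⇒< _ (b i) eq) x≐)))
        where
        to : ∃ (Member x) → (cap i ∸ suc k <ᵇ b i) ≡ true
        to (j , inA l l<f lt x≐′) with uniqueA i j k<f l<f x≐ x≐′
        ... | refl , refl = <⇒<ᵇ≡true lt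
        to (j , inD l l<e x≐′) = ⊥-elim (A-D-disjoint i j k<f (e⇒δ j l<e) x≐ x≐′)

      onD : ∀ i {k} → k ≤ δ i → elemAt S (t i + k) ≡ (k <ᵇ e i)
      onD i {k} k≤δ with elementD i k≤δ
      ... | x , x≐ = trans (elemAt-≐ S x≐) (Bool-ext
              (λ eq → to (member⁻ x eq))
              (λ eq → member⁺ x i (inD k (<ᵇ≡true⇒< k (e i) eq) x≐)))
        where
        to : ∃ (Member x) → (k <ᵇ e i) ≡ true
        to (j , inA l l<f lt x≐′) = ⊥-elim (A-D-disjoint j i l<f k≤δ x≐′ x≐)
        to (j , inD l l<e x≐′) with uniqueD i j k≤δ (e⇒δ j l<e) x≐ x≐′
        ... | refl , refl = <⇒<ᵇ≡true l<e

  -- The map on ideals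

  module _ {I : Subset n} (ideal : IsIdeal I) where

    Φ̄-isRel : Rel prevFin cap (encA I) (encD I) (b₃ I) (e₃ I)
    Φ̄-isRel = Φ̄-rel α δ I (down-code (ideal⇒down ideal))

    Φ̄-code : FilterCode cap δ (b₃ I) (e₃ I)
    Φ̄-code = rel-filterCode cap δ 1≤δ Φ̄-isRel (down-code (ideal⇒down ideal))

    Φ̄-shape : FilterShape (Φ̄ I) (b₃ I) (e₃ I)
    Φ̄-shape = decodeFilter-shape (FilterCode.bound Φ̄-code) (top-≤ {a = b₃ I ∘ nextFin} (FilterCode.top Φ̄-code))

    Φ̄-enc : (∀ i → encA (Φ̄ I) i ≡ b₃ I i) × (∀ i → encD (Φ̄ I) i ≡ e₃ I i)
    Φ̄-enc = filterShape-enc (FilterCode.bound Φ̄-code) (top-≤ {a = b₃ I ∘ nextFin} (FilterCode.top Φ̄-code)) Φ̄-shape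

    Φ̄-filter : IsFilter (Φ̄ I)
    Φ̄-filter = up⇒filter (code-up Φ̄-code Φ̄-shape)

    Φ̄-card : ∣ Φ̄ I ∣ ≡ ∣ I ∣
    Φ̄-card = begin
      ∣ Φ̄ I ∣                                     ≡⟨ card-enc (Φ̄ I) ⟩
      sumFin (encA (Φ̄ I)) + sumFin (encD (Φ̄ I))   ≡⟨ cong₂ _+_ (sumFin-cong (proj₁ Φ̄-enc)) (sumFin-cong (proj₂ Φ̄-enc)) ⟩
      sumFin (b₃ I) + sumFin (e₃ I)               ≡⟨ rel-sum Φ̄-isRel ⟨
      sumFin (encA I) + sumFin (encD I)           ≡⟨ card-enc I ⟨
      ∣ I ∣                                       ∎
      where open ≡-Reasoning

  Φ̄-injective : ∀ {I J} → IsIdeal I → IsIdeal J → Φ̄ I ≡ Φ̄ J → I ≡ J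
  Φ̄-injective {I} {J} idI idJ eq = subset-ext
    (λ i {k} k<f → trans (SI.onA i k<f) (trans (cong (k <ᵇ_) (proj₁ (codes i))) (sym (SJ.onA i k<f))))
    (λ i {k} k≤δ → trans (SI.onD i k≤δ) (trans (cong (δ i ∸ k <ᵇ_) (proj₂ (codes i))) (sym (SJ.onD i k≤δ))))
    where
    module SI = IdealShape (down-shape (ideal⇒down idI))
    module SJ = IdealShape (down-shape (ideal⇒down idJ))

    codes : ∀ i → encA I i ≡ encA J i × encD I i ≡ encD J i
    codes = rel-injective cap δ
      (λ i → trans (sym (proj₁ (Φ̄-enc idI) i)) (trans (cong (λ S → encA S i) eq) (proj₁ (Φ̄-enc idJ) i)))
      (λ i → trans (sym (proj₂ (Φ̄-enc idI) i)) (trans (cong (λ S → encD S i) eq) (proj₂ (Φ̄-enc idJ) i)))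
      (Φ̄-isRel idI) (Φ̄-isRel idJ)

  -- The relation supplies a preimage code, which is decoded to an ideal. The output code that `Φ̄`
  -- computes for this ideal is related to the same input code, so by functionality it is the code
  -- of `U`.
  Φ̄-surjective : ∀ U → IsFilter U → Σ (Subset n) (λ I → IsIdeal I × Φ̄ I ≡ U)
  Φ̄-surjective U filt with rel-surjective cap δ (up-code (filter⇒up filt))
  ... | a , d , r = I , ideal , subset-ext
    (λ i {k} k<f → trans (SI.onA i k<f) (trans (cong (cap i ∸ suc k <ᵇ_) (proj₁ (codes i))) (sym (SU.onA i k<f))))
    (λ i {k} k≤δ → trans (SI.onD i k≤δ) (trans (cong (k <ᵇ_) (proj₂ (codes i))) (sym (SU.onD i k≤δ))))
    where
    I = decodeIdeal a d

    code : IdealCode cap δ a d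
    code = rel-idealCode cap δ 1≤δ r (up-code (filter⇒up filt))

    ideal : IsIdeal I
    ideal = down⇒ideal (code-down code (decodeIdeal-shape a d))

    module SI = FilterShape (Φ̄-shape ideal)
    module SU = FilterShape (up-shape (filter⇒up filt))

    enc : (∀ i → encA I i ≡ a i) × (∀ i → encD I i ≡ d i)
    enc = idealShape-enc (IdealCode.bound code) (top-≤ {a = a} (IdealCode.top code)) (decodeIdeal-shape a d)

    codes : ∀ i → b₃ I i ≡ encA U i × e₃ I i ≡ encD U i
    codes = rel-functional (circle ℓ)
      (rel-cong cap δ (proj₁ enc) (proj₂ enc) (λ _ → refl) (λ _ → refl) (Φ̄-isRel ideal)) r

theorem3p2 : (ℓ : ℕ) → 1 ≤ ℓ → (α δ : Fin ℓ → ℕ) →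
    (∀ i → 1 ≤ α i) → (∀ i → 1 ≤ δ i) →
    let open Fence ℓ α δ in
    (∀ I → IsIdeal I → IsFilter (Φ̄ I))
    × (∀ I → IsIdeal I → ∣ Φ̄ I ∣ ≡ ∣ I ∣)
    × (∀ I J → IsIdeal I → IsIdeal J → Φ̄ I ≡ Φ̄ J → I ≡ J)
    × (∀ U → IsFilter U → Σ (Subset n) (λ I → IsIdeal I × Φ̄ I ≡ U))
theorem3p2 ℓ _ α δ 1≤α 1≤δ =
    (λ I → Φ̄-filter {I})
  , (λ I → Φ̄-card {I})
  , (λ I J → Φ̄-injective)
  , Φ̄-surjective
  where open Geometry ℓ α δ 1≤α 1≤δ
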